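{- Fix a positive integer $j$ and nonnegative integers $m,d$. Let $g(x)=\sum_P x^{\mathrm{size}(P)}$, the sum over all $(j,m,d)$-$U$-$D$ paths $P$. Then \[ \Phi\big(g(x)\big)=\sum_P x^{\mathrm{size}(P)}y^{\mathrm{npa}_j(P)}, \] the sum over all $(j,m,d)$-$U$-$D$ paths, where $\mathrm{npa}_j(P)$ is the number of $j$-nice pyramid ascents of $P$.
   Context: The run transform is $\Phi\big(f(x)\big)=\frac{1-x}{1-xy}\,f\!\left(\frac{x(1-x)}{1-xy}\right)$. Paths are made of $j$-upsteps (each equal to $j$ consecutive unit upsteps $U=(1,1)$) and downsteps $D=(1,-1)$. A $(j,m,d)$-$U$-$D$ path is such a path starting at $(0,m)$, whose lowest point is at level $-d$, and ending on the $x$-axis. Its size is $\lfloor(\text{number of downsteps})/j\rfloor$. Viewing the path as a sequence of unit steps $U,D$: an ascent is a maximal subpath $U^k$ ($k\ge1$); a pyramid is a maximal subpath $U^kD^k$ ($k\ge1$); a pyramid ascent is an ascent that is the first half of a pyramid; it is $j$-nice if it ends at a height (ordinate) divisible by $j$. -}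

module Defs where

open import Data.Bool using (Bool; true; false; _∧_; if_then_else_)
open import Data.Nat as ℕ using (ℕ; zero; suc; _≡ᵇ_; _≤ᵇ_; NonZero)
open import Data.Nat.DivMod using (_/_)
open import Data.Nat.Divisibility using (_∣?_)
open import Data.Integer as ℤ using (ℤ; +_; -_; _⊓_; ∣_∣)
open import Data.List using (List; []; _∷_; _++_; map; concatMap; replicate; length; filterᵇ; upTo)
open import Relation.Nullary.Decidable using (⌊_⌋)

-- Formal power series in x with coefficients in ℤ[y]:
-- a series S is given by its coefficients, S n e = [x^n y^e] S.

Series : Set
Series = ℕ → ℕ → ℤ

sumTo : ℕ → (ℕ → ℤ) → ℤ
sumTo zero    f = f zero
sumTo (suc n) f = sumTo n f ℤ.+ f (suc n)

[_] : Bool → ℤ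
[ true  ] = + 1
[ false ] = + 0

one : Series
one n e = [ (n ≡ᵇ 0) ∧ (e ≡ᵇ 0) ]

X : Series
X n e = [ (n ≡ᵇ 1) ∧ (e ≡ᵇ 0) ]

XY : Series
XY n e = [ (n ≡ᵇ 1) ∧ (e ≡ᵇ 1) ]

_⊕_ : Series → Series → Series
(A ⊕ B) n e = A n e ℤ.+ B n e

⊖_ : Series → Series
(⊖ A) n e = - A n e

_⊛_ : Series → Series → Series
(A ⊛ B) n e = sumTo n λ i → sumTo e λ a → A i a ℤ.* B (n ℕ.∸ i) (e ℕ.∸ a)

pow : Series → ℕ → Series
pow h zero    = one
pow h (suc k) = h ⊛ pow h k

-- Composition f(h) = Σ_k f_k(y) h^k, for h with zero constant term in x
-- (then h^k only contributes to x-degrees ≥ k, so the sum over k ≤ n is exact).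
_∘ₛ_ : Series → Series → Series
(f ∘ₛ h) n e = sumTo n λ k → sumTo e λ a → f k a ℤ.* pow h k n (e ℕ.∸ a)

geom : Series
geom n e = [ e ≡ᵇ 0 ]

-- 1/(1 - h) = Σ_k h^k, for h with zero constant term
recip1- : Series → Series
recip1- h = geom ∘ₛ h

oneMinusX : Series
oneMinusX = one ⊕ (⊖ X)

Φ : Series → Series
Φ f = (oneMinusX ⊛ recip1- XY) ⊛ (f ∘ₛ ((X ⊛ oneMinusX) ⊛ recip1- XY))

data Step : Set where
  U D : Step

data PStep : Set where
  up dn : PStep

units : ℕ → List PStep → List Step
units j []       = []
units j (up ∷ w) = replicate j U ++ units j w
units j (dn ∷ w) = D ∷ units j w

step : Step → ℤ → ℤ
step U h = h ℤ.+ + 1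
step D h = h ℤ.- + 1

heights : ℤ → List Step → List ℤ
heights h []      = h ∷ []
heights h (s ∷ w) = h ∷ heights (step s h) w

endHeight : ℤ → List Step → ℤ
endHeight h []      = h
endHeight h (s ∷ w) = endHeight (step s h) w

minHeight : ℤ → List Step → ℤ
minHeight h []      = h
minHeight h (s ∷ w) = h ⊓ minHeight (step s h) w

_==ℤ_ : ℤ → ℤ → Bool
infix 4 _==ℤ_
a ==ℤ b = ⌊ a ℤ.≟ b ⌋

isPath : ℕ → ℕ → ℕ → List PStep → Bool
isPath j m d w =
  (endHeight (+ m) (units j w) ==ℤ (+ 0)) ∧ (minHeight (+ m) (units j w) ==ℤ (- (+ d)))

countDn : List PStep → ℕ
countDn []       = 0
countDn (up ∷ w) = countDn w
countDn (dn ∷ w) = suc (countDn w)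

size : (j : ℕ) {{_ : NonZero j}} → List PStep → ℕ
size j w = countDn w / j

runU : List Step → ℕ
runU (U ∷ w) = suc (runU w)
runU _       = 0

runD : List Step → ℕ
runD (D ∷ w) = suc (runD w)
runD _       = 0

dropN : ℕ → List Step → List Step
dropN zero    w       = w
dropN (suc k) []      = []
dropN (suc k) (_ ∷ w) = dropN k w

-- npaGo j prevU h w: number of j-nice pyramid ascents among the ascents
-- starting in w, where h is the current height and prevU says whether the
-- step just before w is a U. An ascent U^k starts at a U not preceded by U
-- and is maximal; it is the first half of the (maximal) pyramid U^k D^k iff
-- it is followed by at least k D's; it is j-nice iff it ends at a height
-- divisible by j.
npaGo : ℕ → Bool → ℤ → List Step → ℕ
npaGo j p     h []      = 0
npaGo j p     h (D ∷ w) = npaGo j false (step D h) w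
npaGo j true  h (U ∷ w) = npaGo j true (step U h) w
npaGo j false h (U ∷ w) =
  (if (k ≤ᵇ runD (dropN k (U ∷ w))) ∧ ⌊ j ∣? ∣ h ℤ.+ + k ∣ ⌋ then 1 else 0)
    ℕ.+ npaGo j true (step U h) w
  where
  k : ℕ
  k = runU (U ∷ w)

npa : ℕ → ℕ → List PStep → ℕ
npa j m w = npaGo j false (+ m) (units j w)

words : ℕ → List (List PStep)
words zero    = [] ∷ []
words (suc L) = map (up ∷_) (words L) ++ map (dn ∷_) (words L)

wordsUpTo : ℕ → List (List PStep)
wordsUpTo B = concatMap words (upTo (suc B))

-- Every (j,m,d)-path of size n has fewer than j(n+1) downsteps and at most
-- as many j-upsteps as downsteps, hence at most 2·j·(n+1) steps; so the
-- following lists contain ALL paths of size n.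
candidates : (j : ℕ) → ℕ → List (List PStep)
candidates j n = wordsUpTo (2 ℕ.* j ℕ.* suc n)

gSeries : (j m d : ℕ) {{_ : NonZero j}} → Series
gSeries j m d n zero =
  + length (filterᵇ (λ w → isPath j m d w ∧ (size j w ≡ᵇ n)) (candidates j n))
gSeries j m d n (suc e) = + 0

npaSeries : (j m d : ℕ) {{_ : NonZero j}} → Series
npaSeries j m d n e =
  + length (filterᵇ (λ w → isPath j m d w ∧ (size j w ≡ᵇ n) ∧ (npa j m w ≡ᵇ e))
                    (candidates j n))

{-# OPTIONS --safe #-}
module Submission where

-- Write N for the number of downsteps that remain at a vertex. The vertices where an
-- ascent may be nice are those with j ∣ N, a path of size k has k + 1 of them that are
-- not preceded by an upstep, and a pyramid of height ij inserted there has weight x^i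
-- and leaves end point and lowest point unchanged. Writing y = 1 + (y - 1), i.e. marking
-- some of the nice pyramid ascents, and deleting the marked pyramids leaves an arbitrary
-- path with a sequence of pyramids of weight (y - 1)x^i attached to each of these k + 1
-- vertices, which contributes a factor 1/(1 - (y - 1)x/(1 - x)) = (1 - x)/(1 - xy) each.
-- To avoid marked objects, the resulting identity is proved by recursion on the number
-- of upsteps and downsteps, for any set of words that is invariant under the insertion
-- of pyramids of height j.

open import Defs
open import Data.Bool using (Bool; true; false; _∧_; if_then_else_; T)
open import Data.Bool.Properties using (∧-zeroʳ; ∧-identityʳ)
open import Data.List using (List; []; _∷_; _++_; replicate; map; concatMap; length; filterᵇ; upTo)
open import Data.List.Properties using (++-assoc; ++-identityʳ; upTo-∷ʳ; concatMap-++)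
open import Data.Nat as ℕ using (ℕ; zero; suc; _∸_; _≤_; _<_; z≤n; s≤s; _≡ᵇ_; NonZero)
open import Data.Nat.DivMod using (_/_; _%_; m≡m%n+[m/n]*n; [m+kn]%n≡m%n; m%n<n; +-distrib-/-∣ʳ; m<n⇒m/n≡0; m*n/n≡m)
open import Data.Nat.Divisibility using (_∣_; _∣?_; n∣m*n; ∣m+n∣m⇒∣n; >⇒∤)
import Data.Nat.Properties as ℕ
open import Data.Integer as ℤ using (ℤ; +_; -_; _+_; _*_; _-_)
open import Data.Integer.Divisibility.Signed as Signed using (∣ᵤ⇒∣; ∣⇒∣ᵤ)
import Data.Integer.Properties as ℤ
open import Data.Integer.Tactic.RingSolver using (solve-∀)
open import Data.Product using (∃; _×_; _,_; proj₁)
open import Data.Unit using (tt)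
open import Relation.Nullary using (¬_; yes; no; contradiction)
open import Relation.Nullary.Decidable using (⌊_⌋)
open import Relation.Binary.PropositionalEquality hiding ([_])
open ≡-Reasoning

-- Power series

sumTo-cong : ∀ n {f g : ℕ → ℤ} → (∀ i → i ≤ n → f i ≡ g i) → sumTo n f ≡ sumTo n g
sumTo-cong zero    f≡g = f≡g 0 z≤n
sumTo-cong (suc n) f≡g =
  cong₂ _+_ (sumTo-cong n (λ i i≤n → f≡g i (ℕ.m≤n⇒m≤1+n i≤n))) (f≡g (suc n) ℕ.≤-refl)

sumTo-zero : ∀ n {f : ℕ → ℤ} → (∀ i → i ≤ n → f i ≡ + 0) → sumTo n f ≡ + 0
sumTo-zero zero    f≡0 = f≡0 0 z≤n
sumTo-zero (suc n) f≡0 =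
  cong₂ _+_ (sumTo-zero n (λ i i≤n → f≡0 i (ℕ.m≤n⇒m≤1+n i≤n))) (f≡0 (suc n) ℕ.≤-refl)

+-interchange : ∀ a b c d → (a + b) + (c + d) ≡ (a + c) + (b + d)
+-interchange = solve-∀

sumTo-+ : ∀ n (f g : ℕ → ℤ) → sumTo n (λ i → f i + g i) ≡ sumTo n f + sumTo n g
sumTo-+ zero    f g = refl
sumTo-+ (suc n) f g = trans (cong (_+ (f (suc n) + g (suc n))) (sumTo-+ n f g))
  (+-interchange (sumTo n f) (sumTo n g) (f (suc n)) (g (suc n)))

sumTo-* : ∀ n c (f : ℕ → ℤ) → sumTo n (λ i → c * f i) ≡ c * sumTo n f
sumTo-* zero    c f = refl
sumTo-* (suc n) c f = trans (cong (_+ c * f (suc n)) (sumTo-* n c f))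
  (sym (ℤ.*-distribˡ-+ c (sumTo n f) (f (suc n))))

sumTo-neg : ∀ n (f : ℕ → ℤ) → sumTo n (λ i → - f i) ≡ - sumTo n f
sumTo-neg zero    f = refl
sumTo-neg (suc n) f = trans (cong (_+ - f (suc n)) (sumTo-neg n f))
  (sym (ℤ.neg-distrib-+ (sumTo n f) (f (suc n))))

sumTo-swap : ∀ m n (f : ℕ → ℕ → ℤ) →
  sumTo m (λ i → sumTo n (f i)) ≡ sumTo n (λ k → sumTo m (λ i → f i k))
sumTo-swap zero    n f = refl
sumTo-swap (suc m) n f = trans (cong (_+ sumTo n (f (suc m))) (sumTo-swap m n f))
  (sym (sumTo-+ n (λ k → sumTo m (λ i → f i k)) (f (suc m))))

sumTo-suc : ∀ n (f : ℕ → ℤ) → sumTo (suc n) f ≡ f 0 + sumTo n (λ i → f (suc i))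
sumTo-suc zero    f = refl
sumTo-suc (suc n) f = trans (cong (_+ f (suc (suc n))) (sumTo-suc n f))
  (ℤ.+-assoc (f 0) (sumTo n (λ i → f (suc i))) (f (suc (suc n))))

sumTo-head : ∀ n (f : ℕ → ℤ) → (∀ i → f (suc i) ≡ + 0) → sumTo n f ≡ f 0
sumTo-head zero    f f≡0 = refl
sumTo-head (suc n) f f≡0 = trans (cong₂ _+_ (sumTo-head n f f≡0) (f≡0 n)) (ℤ.+-identityʳ (f 0))

sumTo-tail : ∀ n (f : ℕ → ℤ) → f 0 ≡ + 0 → sumTo (suc n) f ≡ sumTo n (λ i → f (suc i))
sumTo-tail n f f0≡0 = trans (sumTo-suc n f) (trans (cong (_+ rest) f0≡0) (ℤ.+-identityˡ rest))
  where rest = sumTo n (λ i → f (suc i))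

sumTo-extend : ∀ {m n} (f : ℕ → ℤ) → m ≤ n → (∀ i → m < i → f i ≡ + 0) → sumTo m f ≡ sumTo n f
sumTo-extend {m} f m≤n f≡0 = go (ℕ.≤⇒≤′ m≤n)
  where
  go : ∀ {n} → m ℕ.≤′ n → sumTo m f ≡ sumTo n f
  go ℕ.≤′-refl            = refl
  go (ℕ.≤′-step {k} m≤′k) = trans (go m≤′k)
    (sym (trans (cong (ℤ._+_ (sumTo k f)) (f≡0 (suc k) (s≤s (ℕ.≤′⇒≤ m≤′k)))) (ℤ.+-identityʳ _)))

-- Multiplication of a coefficient sequence by the `l`-th power of its variable. It serves for
-- exponents of x, exponents of y and numbers of upsteps alike.
delay : ℕ → (ℕ → ℤ) → ℕ → ℤ
delay zero    f n       = f n
delay (suc l) f zero    = + 0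
delay (suc l) f (suc n) = delay l f n

delay-cong : ∀ l {f g : ℕ → ℤ} → (∀ i → f i ≡ g i) → ∀ n → delay l f n ≡ delay l g n
delay-cong zero    f≡g n       = f≡g n
delay-cong (suc l) f≡g zero    = refl
delay-cong (suc l) f≡g (suc n) = delay-cong l f≡g n

delay-suc : ∀ l (f : ℕ → ℤ) n → delay (suc l) f n ≡ delay 1 (delay l f) n
delay-suc l f zero    = refl
delay-suc l f (suc n) = refl

delay-comm : ∀ l (f : ℕ → ℤ) n → delay l (delay 1 f) n ≡ delay 1 (delay l f) n
delay-comm zero    f n             = refl
delay-comm (suc l) f zero          = refl
delay-comm (suc l) f (suc zero)    = delay-comm l f zero
delay-comm (suc l) f (suc (suc n)) = delay-comm l f (suc n)

delay-+ : ∀ l (f g : ℕ → ℤ) n → delay l (λ i → f i + g i) n ≡ delay l f n + delay l g n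
delay-+ zero    f g n       = refl
delay-+ (suc l) f g zero    = refl
delay-+ (suc l) f g (suc n) = delay-+ l f g n

delay-≤ : ∀ {l n} (f : ℕ → ℤ) → l ≤ n → delay l f n ≡ f (n ∸ l)
delay-≤ f z≤n       = refl
delay-≤ f (s≤s l≤n) = delay-≤ f l≤n

delay-> : ∀ {l n} (f : ℕ → ℤ) → n < l → delay l f n ≡ + 0
delay-> {suc l} {zero}  f n<l       = refl
delay-> {suc l} {suc n} f (s≤s n<l) = delay-> f n<l

infix 4 _≈_
_≈_ : Series → Series → Set
A ≈ B = ∀ n e → A n e ≡ B n e

≈-trans : ∀ {A B C : Series} → A ≈ B → B ≈ C → A ≈ C
≈-trans A≈B B≈C n e = trans (A≈B n e) (B≈C n e)

⊛-cong : ∀ {A A′ B B′ : Series} → A ≈ A′ → B ≈ B′ → A ⊛ B ≈ A′ ⊛ B′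
⊛-cong A≈ B≈ n e = sumTo-cong n λ i _ → sumTo-cong e λ a _ →
  cong₂ _*_ (A≈ i a) (B≈ (n ∸ i) (e ∸ a))

-- Products with x^k and with xy become index shifts, which compute on coefficients.
xShift : ℕ → Series → Series
xShift k A n e = delay k (λ i → A i e) n

xyShift : Series → Series
xyShift A n e = delay 1 (λ i → delay 1 (A i) e) n

xShift-cong : ∀ k {A B : Series} → A ≈ B → xShift k A ≈ xShift k B
xShift-cong k A≈B n e = delay-cong k (λ i → A≈B i e) n

one-⊛ : ∀ A → one ⊛ A ≈ A
one-⊛ A n e = trans
  (sumTo-head n _ (λ i → sumTo-zero e (λ _ _ → refl)))
  (trans (sumTo-head e _ (λ _ → refl)) (ℤ.*-identityˡ (A n e)))

⊕-⊛ : ∀ A B C → (A ⊕ B) ⊛ C ≈ (A ⊛ C) ⊕ (B ⊛ C)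
⊕-⊛ A B C n e = trans
  (sumTo-cong n (λ i _ → trans
    (sumTo-cong e (λ a _ → ℤ.*-distribʳ-+ (C (n ∸ i) (e ∸ a)) (A i a) (B i a)))
    (sumTo-+ e _ _)))
  (sumTo-+ n _ _)

⊖-⊛ : ∀ A C → (⊖ A) ⊛ C ≈ ⊖ (A ⊛ C)
⊖-⊛ A C n e = trans
  (sumTo-cong n (λ i _ → trans
    (sumTo-cong e (λ a _ → sym (ℤ.neg-distribˡ-* (A i a) (C (n ∸ i) (e ∸ a)))))
    (sumTo-neg e _)))
  (sumTo-neg n _)

xShift-⊛ : ∀ A B → xShift 1 A ⊛ B ≈ xShift 1 (A ⊛ B)
xShift-⊛ A B zero    e = sumTo-zero e (λ _ _ → refl)
xShift-⊛ A B (suc n) e = sumTo-tail n _ (sumTo-zero e (λ _ _ → refl))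

xyShift-⊛ : ∀ A B → xyShift A ⊛ B ≈ xyShift (A ⊛ B)
xyShift-⊛ A B zero    e       = sumTo-zero e (λ _ _ → refl)
xyShift-⊛ A B (suc n) zero    =
  trans (sumTo-tail n _ refl) (sumTo-zero n (λ _ _ → refl))
xyShift-⊛ A B (suc n) (suc e) =
  trans (sumTo-tail n _ (sumTo-zero (suc e) (λ _ _ → refl)))
    (sumTo-cong n (λ i _ → sumTo-tail e _ refl))

⊛-xShift : ∀ A B → A ⊛ xShift 1 B ≈ xShift 1 (A ⊛ B)
⊛-xShift A B zero    e = sumTo-zero e (λ a _ → ℤ.*-zeroʳ (A 0 a))
⊛-xShift A B (suc n) e = trans
  (cong₂ _+_
    (sumTo-cong n (λ i i≤n → sumTo-cong e (λ a _ →
      cong (λ t → A i a * xShift 1 B t (e ∸ a)) (ℕ.+-∸-assoc 1 i≤n))))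
    (sumTo-zero e (λ a _ → trans
      (cong (λ t → A (suc n) a * xShift 1 B t (e ∸ a)) (ℕ.n∸n≡0 n))
      (ℤ.*-zeroʳ (A (suc n) a)))))
  (ℤ.+-identityʳ _)

⊛-xShiftᵏ : ∀ k A B → A ⊛ xShift k B ≈ xShift k (A ⊛ B)
⊛-xShiftᵏ zero    A B n e = refl
⊛-xShiftᵏ (suc k) A B n e = begin
  (A ⊛ xShift (suc k) B) n e
    ≡⟨ ⊛-cong {A} {A} (λ _ _ → refl) (λ i c → delay-suc k (λ i → B i c) i) n e ⟩
  (A ⊛ xShift 1 (xShift k B)) n e
    ≡⟨ ⊛-xShift A (xShift k B) n e ⟩
  xShift 1 (A ⊛ xShift k B) n e
    ≡⟨ xShift-cong 1 (⊛-xShiftᵏ k A B) n e ⟩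
  xShift 1 (xShift k (A ⊛ B)) n e
    ≡⟨ delay-suc k (λ i → (A ⊛ B) i e) n ⟨
  xShift (suc k) (A ⊛ B) n e ∎

X≈ : X ≈ xShift 1 one
X≈ zero    e = refl
X≈ (suc n) e = refl

XY≈ : XY ≈ xyShift one
XY≈ zero          e       = refl
XY≈ (suc zero)    zero    = refl
XY≈ (suc (suc n)) zero    = refl
XY≈ (suc n)       (suc e) = refl

X-⊛ : ∀ A → X ⊛ A ≈ xShift 1 A
X-⊛ A = ≈-trans (⊛-cong {B = A} X≈ (λ _ _ → refl))
  (≈-trans (xShift-⊛ one A) (xShift-cong 1 (one-⊛ A)))

XY-⊛ : ∀ A → XY ⊛ A ≈ xyShift A
XY-⊛ A = ≈-trans (⊛-cong {B = A} XY≈ (λ _ _ → refl))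
  (≈-trans (xyShift-⊛ one A)
    (λ n e → delay-cong 1 (λ i → delay-cong 1 (one-⊛ A i) e) n))

oneMinusX-⊛ : ∀ A n e → (oneMinusX ⊛ A) n e ≡ A n e - xShift 1 A n e
oneMinusX-⊛ A n e = trans (⊕-⊛ one (⊖ X) A n e)
  (cong₂ _+_ (one-⊛ A n e) (trans (⊖-⊛ X A n e) (cong -_ (X-⊛ A n e))))

-- Coefficients free of y leave only the term `a = 0` of the inner sum.
composeConst : ∀ f h → (∀ k a → f k (suc a) ≡ + 0) →
  ∀ n e → (f ∘ₛ h) n e ≡ sumTo n (λ k → f k 0 * pow h k n e)
composeConst f h const n e = sumTo-cong n λ k _ →
  sumTo-head e _ (λ a → cong (_* pow h k n (e ∸ suc a)) (const k a))

-- The term k = 0 of the geometric series in xy is split off, and a factor xy is taken out of all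
-- later powers.
recip1-XY-eq : ∀ n e → recip1- XY n e ≡ one n e + xyShift (recip1- XY) n e
recip1-XY-eq n e = trans (expand n e) (go n e)
  where
  expand : ∀ n e → recip1- XY n e ≡ sumTo n (λ k → pow XY k n e)
  expand n e = trans (composeConst geom XY (λ _ _ → refl) n e)
    (sumTo-cong n (λ k _ → ℤ.*-identityˡ (pow XY k n e)))
  go : ∀ n e → sumTo n (λ k → pow XY k n e) ≡ one n e + xyShift (recip1- XY) n e
  go zero    e       = sym (ℤ.+-identityʳ (one 0 e))
  go (suc n) e       = trans (sumTo-suc n _) (cong (ℤ._+_ (one (suc n) e))
    (trans (sumTo-cong n (λ k _ → XY-⊛ (pow XY k) (suc n) e)) (shift e)))
    where
    shift : ∀ e → sumTo n (λ k → delay 1 (pow XY k n) e) ≡ delay 1 (recip1- XY n) e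
    shift zero    = sumTo-zero n (λ _ _ → refl)
    shift (suc e) = sym (expand n e)

-- The factor (1 - x)/(1 - xy)

ratio : Series
ratio = oneMinusX ⊛ recip1- XY

-- The equation R = 1 + xy R for R = 1/(1 - xy), multiplied by 1 - x.
ratio-eq : ∀ n e → ratio n e ≡ (one n e - X n e) + xyShift ratio n e
ratio-eq n e = trans (lhs n e) (trans (go n e) (cong (ℤ._+_ (one n e - X n e))
    (sym (delay-cong 1 (λ i → delay-cong 1 (lhs i) e) n))))
  where
  R = recip1- XY
  Δ : Series
  Δ n e = R n e - xShift 1 R n e
  lhs : ratio ≈ Δ
  lhs = oneMinusX-⊛ R
  cancel : ∀ a b c d → (a + b) - (c + d) ≡ (a - c) + (b - d)
  cancel = solve-∀
  go : ∀ n e → Δ n e ≡ (one n e - X n e) + xyShift Δ n e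
  go zero    e = cong₂ _+_ (trans (recip1-XY-eq zero e) refl) refl
  go (suc n) e = trans
    (cong₂ _-_ (recip1-XY-eq (suc n) e) (recip1-XY-eq n e))
    (trans (cancel (one (suc n) e) (delay 1 (R n) e) (one n e) (xyShift R n e))
      (cong (ℤ._+_ (one (suc n) e - X (suc n) e)) (shift n e)))
    where
    shift : ∀ n e → delay 1 (R n) e - xyShift R n e ≡ delay 1 (Δ n) e
    shift zero    zero    = refl
    shift (suc n) zero    = refl
    shift zero    (suc e) = refl
    shift (suc n) (suc e) = refl

ratio-⊛ : ∀ T n e → (ratio ⊛ T) n e ≡ (T n e - xShift 1 T n e) + xyShift (ratio ⊛ T) n e
ratio-⊛ T n e = trans (⊛-cong {B = T} ratio-eq (λ _ _ → refl) n e)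
  (trans (⊕-⊛ oneMinusX (xyShift ratio) T n e)
    (cong₂ _+_ (oneMinusX-⊛ T n e) (xyShift-⊛ ratio T n e)))

substituted≈ : (X ⊛ oneMinusX) ⊛ recip1- XY ≈ xShift 1 ratio
substituted≈ = ≈-trans (⊛-cong {B = recip1- XY} (X-⊛ oneMinusX) (λ _ _ → refl))
  (xShift-⊛ oneMinusX (recip1- XY))

pow-substituted : ∀ k → pow ((X ⊛ oneMinusX) ⊛ recip1- XY) k ≈ xShift k (pow ratio k)
pow-substituted zero    n e = refl
pow-substituted (suc k) n e = begin
  pow ((X ⊛ oneMinusX) ⊛ recip1- XY) (suc k) n e
    ≡⟨ ⊛-cong {B = pow _ k} {B′ = xShift k (pow ratio k)} substituted≈ (pow-substituted k) n e ⟩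
  (xShift 1 ratio ⊛ xShift k (pow ratio k)) n e
    ≡⟨ xShift-⊛ ratio (xShift k (pow ratio k)) n e ⟩
  xShift 1 (ratio ⊛ xShift k (pow ratio k)) n e
    ≡⟨ xShift-cong 1 (⊛-xShiftᵏ k ratio (pow ratio k)) n e ⟩
  xShift 1 (xShift k (pow ratio (suc k))) n e
    ≡⟨ delay-suc k (λ i → pow ratio (suc k) i e) n ⟨
  xShift (suc k) (pow ratio (suc k)) n e ∎

-- The substituted argument is x times `ratio`, so its k-th power and the prefactor combine to x^k
-- `ratio`^(k + 1): one factor for each of the k + 1 places of insertion.
Φ-expand : ∀ f → (∀ k a → f k (suc a) ≡ + 0) →
  ∀ n e → Φ f n e ≡ sumTo n (λ k → pow ratio (suc k) (n ∸ k) e * f k 0)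
Φ-expand f const n e = begin
  Φ f n e
    ≡⟨ sumTo-cong n (λ i _ → trans
         (sumTo-cong e (λ a _ → trans
           (cong (ratio i a *_) (expand i (e ∸ a)))
           (trans (sym (sumTo-* n (ratio i a) _))
             (sumTo-cong n (λ k _ → move (ratio i a) (f k 0) _)))))
         (sumTo-swap e n _)) ⟩
  sumTo n (λ i → sumTo n (λ k → sumTo e (λ a → f k 0 * (ratio i a * H k (n ∸ i) (e ∸ a)))))
    ≡⟨ sumTo-swap n n _ ⟩
  sumTo n (λ k → sumTo n (λ i → sumTo e (λ a → f k 0 * (ratio i a * H k (n ∸ i) (e ∸ a)))))
    ≡⟨ sumTo-cong n (λ k k≤n → trans
         (trans (sumTo-cong n (λ i _ → sumTo-* e (f k 0) _)) (sumTo-* n (f k 0) _))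
         (trans (cong (f k 0 *_) (coefficient k k≤n)) (ℤ.*-comm (f k 0) _))) ⟩
  sumTo n (λ k → pow ratio (suc k) (n ∸ k) e * f k 0) ∎
  where
  H : ℕ → Series
  H = pow ((X ⊛ oneMinusX) ⊛ recip1- XY)
  move : ∀ a b c → a * (b * c) ≡ b * (a * c)
  move = solve-∀
  expand : ∀ i c → (f ∘ₛ ((X ⊛ oneMinusX) ⊛ recip1- XY)) (n ∸ i) c ≡
    sumTo n (λ k → f k 0 * H k (n ∸ i) c)
  expand i c = trans (composeConst f _ const (n ∸ i) c)
    -- `H k` starts at x^k, so the sum may run to `n` for every `i`; a range independent of `i`
    -- permits the exchange of sums.
    (sumTo-extend _ (ℕ.m∸n≤m n i) (λ k n∸i<k → trans
      (cong (f k 0 *_) (trans (pow-substituted k (n ∸ i) c) (delay-> _ n∸i<k)))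
      (ℤ.*-zeroʳ (f k 0))))
  coefficient : ∀ k → k ≤ n → (ratio ⊛ H k) n e ≡ pow ratio (suc k) (n ∸ k) e
  coefficient k k≤n = trans (⊛-cong {ratio} {B = H k} {B′ = xShift k (pow ratio k)} (λ _ _ → refl) (pow-substituted k) n e)
    (trans (⊛-xShiftᵏ k ratio (pow ratio k) n e) (delay-≤ _ k≤n))

-- Words and pyramids

Word : Set
Word = List PStep

-- The words with `a` upsteps and `N` downsteps, enumerated by first step; fixing both counts makes
-- induction on `a` and `N` available.
wordSum : ℕ → ℕ → (Word → ℤ) → ℤ
wordSum zero    zero    φ = φ []
wordSum (suc a) zero    φ = wordSum a zero (λ w → φ (up ∷ w))
wordSum zero    (suc N) φ = wordSum zero N (λ w → φ (dn ∷ w))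
wordSum (suc a) (suc N) φ =
  wordSum a (suc N) (λ w → φ (up ∷ w)) + wordSum (suc a) N (λ w → φ (dn ∷ w))

-- `delay` covers the words without upsteps, so that `a` can stay a variable.
wordSum-suc : ∀ a N φ → wordSum a (suc N) φ ≡
  delay 1 (λ b → wordSum b (suc N) (λ w → φ (up ∷ w))) a + wordSum a N (λ w → φ (dn ∷ w))
wordSum-suc zero    N φ = sym (ℤ.+-identityˡ _)
wordSum-suc (suc a) N φ = refl

wordSum-cong : ∀ a N {φ ψ : Word → ℤ} → (∀ w → countDn w ≡ N → φ w ≡ ψ w) →
  wordSum a N φ ≡ wordSum a N ψ
wordSum-cong zero    zero    φ≡ψ = φ≡ψ [] refl
wordSum-cong (suc a) zero    φ≡ψ = wordSum-cong a zero (λ w → φ≡ψ (up ∷ w))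
wordSum-cong zero    (suc N) φ≡ψ = wordSum-cong zero N (λ w eq → φ≡ψ (dn ∷ w) (cong suc eq))
wordSum-cong (suc a) (suc N) φ≡ψ = cong₂ _+_
  (wordSum-cong a (suc N) (λ w → φ≡ψ (up ∷ w)))
  (wordSum-cong (suc a) N (λ w eq → φ≡ψ (dn ∷ w) (cong suc eq)))

wordSum-+ : ∀ a N (φ ψ : Word → ℤ) →
  wordSum a N (λ w → φ w + ψ w) ≡ wordSum a N φ + wordSum a N ψ
wordSum-+ zero    zero    φ ψ = refl
wordSum-+ (suc a) zero    φ ψ = wordSum-+ a zero _ _
wordSum-+ zero    (suc N) φ ψ = wordSum-+ zero N _ _
wordSum-+ (suc a) (suc N) φ ψ = trans
  (cong₂ _+_ (wordSum-+ a (suc N) _ _) (wordSum-+ (suc a) N _ _))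
  (+-interchange (wordSum a (suc N) (λ w → φ (up ∷ w))) (wordSum a (suc N) (λ w → ψ (up ∷ w)))
    (wordSum (suc a) N (λ w → φ (dn ∷ w))) (wordSum (suc a) N (λ w → ψ (dn ∷ w))))

wordSum-* : ∀ a N c (φ : Word → ℤ) → wordSum a N (λ w → c * φ w) ≡ c * wordSum a N φ
wordSum-* zero    zero    c φ = refl
wordSum-* (suc a) zero    c φ = wordSum-* a zero c _
wordSum-* zero    (suc N) c φ = wordSum-* zero N c _
wordSum-* (suc a) (suc N) c φ = trans
  (cong₂ _+_ (wordSum-* a (suc N) c _) (wordSum-* (suc a) N c _))
  (sym (ℤ.*-distribˡ-+ c (wordSum a (suc N) (λ w → φ (up ∷ w)))
    (wordSum (suc a) N (λ w → φ (dn ∷ w)))))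

wordSum-zero : ∀ a N → wordSum a N (λ _ → + 0) ≡ + 0
wordSum-zero a N = wordSum-* a N (+ 0) (λ _ → + 0)

mask : Bool → ℤ → ℤ
mask b z = if b then z else + 0

beginsWithDowns : ℕ → Word → Bool
beginsWithDowns zero    w        = true
beginsWithDowns (suc t) []       = false
beginsWithDowns (suc t) (up ∷ w) = false
beginsWithDowns (suc t) (dn ∷ w) = beginsWithDowns t w

-- Whether the current ascent, of which k upsteps precede w, is a pyramid ascent.
completesPyramid : ℕ → ℕ → Word → Bool
completesPyramid j k (up ∷ w) = completesPyramid j (suc k) w
completesPyramid j k []       = beginsWithDowns (k ℕ.* j) []
completesPyramid j k (dn ∷ w) = beginsWithDowns (k ℕ.* j) (dn ∷ w)

startsPyramid : ℕ → Word → Bool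
startsPyramid j []       = false
startsPyramid j (dn ∷ w) = false
startsPyramid j (up ∷ w) = completesPyramid j 1 w

-- Since a path ends at height 0 and upsteps have height j, the height of a
-- vertex is divisible by j iff the number of downsteps still to come is.
npaSuffix : ℕ → Bool → Word → ℕ
npaSuffix j p     []       = 0
npaSuffix j p     (dn ∷ w) = npaSuffix j false w
npaSuffix j true  (up ∷ w) = npaSuffix j true w
npaSuffix j false (up ∷ w) =
  (if completesPyramid j 1 w ∧ ⌊ j ∣? countDn w ⌋ then 1 else 0) ℕ.+ npaSuffix j true w

wordSum-downs : ∀ t a M (φ : Word → ℤ) →
  wordSum a (t ℕ.+ M) (λ w → mask (beginsWithDowns t w) (φ w)) ≡
  wordSum a M (λ w → φ (replicate t dn ++ w))
wordSum-downs zero    a       M φ = refl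
wordSum-downs (suc t) zero    M φ = wordSum-downs t zero M (λ w → φ (dn ∷ w))
wordSum-downs (suc t) (suc a) M φ = trans
  (cong₂ _+_ (wordSum-zero a (suc (t ℕ.+ M))) (wordSum-downs t (suc a) M (λ w → φ (dn ∷ w))))
  (ℤ.+-identityˡ _)

wordSum-noDowns : ∀ t a N (φ : Word → ℤ) → N < t →
  wordSum a N (λ w → mask (beginsWithDowns t w) (φ w)) ≡ + 0
wordSum-noDowns (suc t) zero    zero    φ N<t       = refl
wordSum-noDowns (suc t) (suc a) zero    φ N<t       = wordSum-zero a zero
wordSum-noDowns (suc t) zero    (suc N) φ (s≤s N<t) = wordSum-noDowns t zero N _ N<t
wordSum-noDowns (suc t) (suc a) (suc N) φ (s≤s N<t) =
  cong₂ _+_ (wordSum-zero a (suc N)) (wordSum-noDowns t (suc a) N _ N<t)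

-- The sum over t ≥ 1 of what is left once a pyramid of height tj is deleted from words with `a`
-- upsteps and Kj downsteps.
pyramidSum : ℕ → (Word → ℤ) → ℕ → ℕ → ℤ
pyramidSum j ψ zero    K       = + 0
pyramidSum j ψ (suc a) zero    = + 0
pyramidSum j ψ (suc a) (suc K) = wordSum a (K ℕ.* j) ψ + pyramidSum j ψ a K

-- Further upsteps only raise the number of downsteps required, so fewer than kj of them never
-- suffice.
wordSum-noPyramid : ∀ j k a N (φ : Word → ℤ) → N < k ℕ.* j →
  wordSum a N (λ w → mask (completesPyramid j k w) (φ w)) ≡ + 0
wordSum-noPyramid j k zero    zero    φ N<kj with k ℕ.* j | N<kj
... | suc t | _ = refl
wordSum-noPyramid j k (suc a) zero    φ N<kj =
  wordSum-noPyramid j (suc k) a zero _ (ℕ.<-≤-trans N<kj (ℕ.m≤n+m _ j))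
wordSum-noPyramid j k zero    (suc N) φ N<kj = wordSum-noDowns (k ℕ.* j) zero (suc N) φ N<kj
wordSum-noPyramid j k (suc a) (suc N) φ N<kj with k ℕ.* j in eq | N<kj
... | suc t | s≤s N<t = cong₂ _+_
  (wordSum-noPyramid j (suc k) a (suc N) _
    (subst (λ s → suc N < j ℕ.+ s) (sym eq) (ℕ.<-≤-trans (s≤s N<t) (ℕ.m≤n+m _ j))))
  (wordSum-noDowns t (suc a) N _ N<t)

replicate-+ : ∀ {A : Set} m n {x : A} → replicate (m ℕ.+ n) x ≡ replicate m x ++ replicate n x
replicate-+ zero    n = refl
replicate-+ (suc m) n = cong (_ ∷_) (replicate-+ m n)

-- Either the ascent ends here: the next (k + 1)j steps are forced down, and the rest gives the
-- first term of `pyramidSum`. Or it goes on, which uses up j of the Kj spare downsteps.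
wordSum-pyramid : ∀ j′ k K a (φ ψ : Word → ℤ) → let j = suc j′ in
  (∀ t w → φ (replicate t up ++ replicate ((suc k ℕ.+ t) ℕ.* j) dn ++ w) ≡ ψ w) →
  wordSum a ((suc k ℕ.+ K) ℕ.* j) (λ w → mask (completesPyramid j (suc k) w) (φ w)) ≡
  pyramidSum j ψ (suc a) (suc K)
wordSum-pyramid j′ k K a φ ψ hyp = begin
  wordSum a ((suc k ℕ.+ K) ℕ.* j) f
    ≡⟨ cong (λ N → wordSum a N f) (ℕ.*-distribʳ-+ j (suc k) K) ⟩
  wordSum a (suc k ℕ.* j ℕ.+ K ℕ.* j) f
    ≡⟨ wordSum-suc a (j′ ℕ.+ k ℕ.* j ℕ.+ K ℕ.* j) f ⟩
  delay 1 (λ b → wordSum b (suc k ℕ.* j ℕ.+ K ℕ.* j) (λ w → f (up ∷ w))) a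
    + wordSum a (j′ ℕ.+ k ℕ.* j ℕ.+ K ℕ.* j) (λ w → f (dn ∷ w))
    ≡⟨ cong₂ _+_ (higher a K) (trans
         (wordSum-downs (j′ ℕ.+ k ℕ.* j) a (K ℕ.* j) (λ w → φ (dn ∷ w)))
         (wordSum-cong a (K ℕ.* j) (λ w _ → hyp₀ w))) ⟩
  pyramidSum j ψ a K + wordSum a (K ℕ.* j) ψ
    ≡⟨ ℤ.+-comm (pyramidSum j ψ a K) (wordSum a (K ℕ.* j) ψ) ⟩
  pyramidSum j ψ (suc a) (suc K) ∎
  where
  j = suc j′
  f : Word → ℤ
  f w = mask (completesPyramid j (suc k) w) (φ w)
  hyp₀ : ∀ w → φ (replicate (suc k ℕ.* j) dn ++ w) ≡ ψ w
  hyp₀ w = trans (cong (λ l → φ (replicate (l ℕ.* j) dn ++ w)) (sym (ℕ.+-identityʳ (suc k))))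
    (hyp 0 w)
  higher : ∀ a K → delay 1 (λ b → wordSum b (suc k ℕ.* j ℕ.+ K ℕ.* j) (λ w → f (up ∷ w))) a ≡
    pyramidSum j ψ a K
  higher zero    K       = refl
  -- Without spare downsteps, a further upstep leaves too few of them for a pyramid.
  higher (suc a) zero    = wordSum-noPyramid j (suc (suc k)) a _ (λ w → φ (up ∷ w))
    (subst (ℕ._< suc (suc k) ℕ.* j) (sym (ℕ.+-identityʳ (suc k ℕ.* j)))
      (ℕ.m<n+m (suc k ℕ.* j) (s≤s z≤n)))
  higher (suc a) (suc K) = trans
    (cong (λ N → wordSum a N (λ w → f (up ∷ w)))
      (trans (sym (ℕ.*-distribʳ-+ j (suc k) (suc K))) (cong (ℕ._* j) (ℕ.+-suc (suc k) K))))
    (wordSum-pyramid j′ (suc k) K a (λ w → φ (up ∷ w)) ψ (λ t w →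
      trans (cong (λ l → φ (up ∷ replicate t up ++ replicate (l ℕ.* j) dn ++ w))
        (sym (ℕ.+-suc (suc k) t))) (hyp (suc t) w)))

-- The arbitrary prefix `p` makes the property pass to `λ w → χ (up ∷ w)` and `λ w → χ (dn ∷ w)`,
-- the tests that remain after a first step.
PyramidInvariant : ℕ → (Word → Bool) → Set
PyramidInvariant j χ = ∀ p w → χ (p ++ up ∷ replicate j dn ++ w) ≡ χ (p ++ w)

-- Tall pyramids are nested insertions: one of height tj sits at the peak of one of height j.
pyramid-invariant : ∀ j χ → PyramidInvariant j χ →
  ∀ t w → χ (replicate t up ++ replicate (t ℕ.* j) dn ++ w) ≡ χ w
pyramid-invariant j χ inv zero    w = refl
pyramid-invariant j χ inv (suc t) w = begin
  χ (up ∷ replicate t up ++ replicate (j ℕ.+ t ℕ.* j) dn ++ w)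
    ≡⟨ cong (λ v → χ (up ∷ replicate t up ++ v)) (begin
         replicate (j ℕ.+ t ℕ.* j) dn ++ w
           ≡⟨ cong (λ l → replicate l dn ++ w) (ℕ.+-comm j (t ℕ.* j)) ⟩
         replicate (t ℕ.* j ℕ.+ j) dn ++ w
           ≡⟨ cong (_++ w) (replicate-+ (t ℕ.* j) j) ⟩
         (replicate (t ℕ.* j) dn ++ replicate j dn) ++ w
           ≡⟨ ++-assoc (replicate (t ℕ.* j) dn) (replicate j dn) w ⟩
         replicate (t ℕ.* j) dn ++ replicate j dn ++ w ∎) ⟩
  χ (up ∷ replicate t up ++ replicate (t ℕ.* j) dn ++ replicate j dn ++ w)
    ≡⟨ pyramid-invariant j (λ v → χ (up ∷ v)) (λ p → inv (up ∷ p)) t (replicate j dn ++ w) ⟩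
  χ (up ∷ replicate j dn ++ w)
    ≡⟨ inv [] w ⟩
  χ w ∎

-- The upsteps continue an ascent that is already accounted for, and the first of the `suc s`
-- downsteps resets the flag.
npaSuffix-pyramid : ∀ j t s w →
  npaSuffix j true (replicate t up ++ replicate (suc s) dn ++ w) ≡ npaSuffix j false w
npaSuffix-pyramid j (suc t) s       w = npaSuffix-pyramid j t s w
npaSuffix-pyramid j zero    zero    w = refl
npaSuffix-pyramid j zero    (suc s) w = downs s
  where
  downs : ∀ s → npaSuffix j false (replicate (suc s) dn ++ w) ≡ npaSuffix j false w
  downs zero    = refl
  downs (suc s) = downs s

-- Counting words by their nice pyramid ascents

term : ℕ → Bool → (Word → Bool) → ℕ → Word → ℤ
term j p χ e w = [ χ w ∧ (npaSuffix j p w ≡ᵇ e) ]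

-- The coefficient of y^e in the count of words satisfying `χ`. The flag `p` tells whether an upstep
-- precedes; if so, upsteps at the start of a word continue an earlier ascent and count nothing.
weighted : ℕ → Bool → (Word → Bool) → ℕ → ℕ → ℕ → ℤ
weighted j p χ a N e = wordSum a N (term j p χ e)

unweighted : (Word → Bool) → ℕ → ℕ → ℤ
unweighted χ a N = wordSum a N (λ w → [ χ w ])

multiple : ∀ j {N} → j ∣ N → ⌊ j ∣? N ⌋ ≡ true
multiple j {N} j∣N with j ∣? N
... | yes _   = refl
... | no  j∤N = contradiction j∣N j∤N

notMultiple : ∀ j {N} → ¬ (j ∣ N) → ⌊ j ∣? N ⌋ ≡ false
notMultiple j {N} j∤N with j ∣? N
... | yes j∣N = contradiction j∣N j∤N
... | no  _   = refl

-- The flag affects only an ascent at the very start, which cannot be nice here.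
npaSuffix-notNice : ∀ j w → ¬ (j ∣ countDn w) → npaSuffix j false w ≡ npaSuffix j true w
npaSuffix-notNice j []       j∤N = refl
npaSuffix-notNice j (dn ∷ w) j∤N = refl
npaSuffix-notNice j (up ∷ w) j∤N rewrite notMultiple j j∤N | ∧-zeroʳ (completesPyramid j 1 w) = refl

weighted-notNice : ∀ j χ a N e → ¬ (j ∣ N) → weighted j false χ a N e ≡ weighted j true χ a N e
weighted-notNice j χ a N e j∤N = wordSum-cong a N λ w N≡ →
  cong (λ s → [ χ w ∧ (s ≡ᵇ e) ]) (npaSuffix-notNice j w (λ j∣ → j∤N (subst (j ∣_) N≡ j∣)))

-- The words whose first ascent is a pyramid ascent, weighted without that ascent.
peak : ℕ → (Word → Bool) → ℕ → Word → ℤ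
peak j χ e w = mask (startsPyramid j w) (term j true χ e w)

-- A first ascent that completes a pyramid contributes y = 1 + (y - 1), where `delay 1` in the
-- exponent `e` multiplies by y. For all other words the flag makes no difference and `peak`
-- vanishes.
term-nice : ∀ j χ e w → j ∣ countDn w →
  term j false χ e w ≡ term j true χ e w + (delay 1 (λ c → peak j χ c w) e - peak j χ e w)
term-nice j χ zero    []       j∣N = sym (ℤ.+-identityʳ _)
term-nice j χ (suc e) []       j∣N = sym (ℤ.+-identityʳ _)
term-nice j χ zero    (dn ∷ w) j∣N = sym (ℤ.+-identityʳ _)
term-nice j χ (suc e) (dn ∷ w) j∣N = sym (ℤ.+-identityʳ _)
term-nice j χ e       (up ∷ w) j∣N rewrite multiple j j∣N with completesPyramid j 1 w
term-nice j χ zero    (up ∷ w) j∣N | false = sym (ℤ.+-identityʳ _)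
term-nice j χ (suc e) (up ∷ w) j∣N | false = sym (ℤ.+-identityʳ _)
term-nice j χ zero    (up ∷ w) j∣N | true  =
  trans (cong [_] (∧-zeroʳ (χ (up ∷ w)))) (cancel (term j true χ 0 (up ∷ w)))
  where
  cancel : ∀ s → + 0 ≡ s + (+ 0 - s)
  cancel = solve-∀
term-nice j χ (suc e) (up ∷ w) j∣N | true  =
  cancel (term j true χ e (up ∷ w)) (term j true χ (suc e) (up ∷ w))
  where
  cancel : ∀ s t → s ≡ t + (s - t)
  cancel = solve-∀

-- Deleting the first pyramid preserves `χ` by invariance and leaves a word that follows a downstep,
-- hence the flag `false`.
peakSum : ∀ j′ χ → PyramidInvariant (suc j′) χ → ∀ a K e →
  wordSum a (K ℕ.* suc j′) (peak (suc j′) χ e) ≡ pyramidSum (suc j′) (term (suc j′) false χ e) a K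
peakSum j′ χ inv zero    K       e = noUps (K ℕ.* suc j′)
  where
  noUps : ∀ N → wordSum zero N (peak (suc j′) χ e) ≡ + 0
  noUps zero    = refl
  noUps (suc N) = wordSum-zero zero N
peakSum j′ χ inv (suc a) zero    e = wordSum-noPyramid (suc j′) 1 a zero
  (λ w → term (suc j′) true χ e (up ∷ w)) (s≤s z≤n)
peakSum j′ χ inv (suc a) (suc K) e = trans
  (cong₂ _+_
    (wordSum-pyramid j′ 0 K a (λ w → term j true χ e (up ∷ w)) (term j false χ e) (λ t w →
      cong₂ (λ b s → [ b ∧ (s ≡ᵇ e) ]) (pyramid-invariant j χ inv (suc t) w)
        (npaSuffix-pyramid j t (j′ ℕ.+ t ℕ.* j) w)))
    (wordSum-zero (suc a) (j′ ℕ.+ K ℕ.* j)))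
  (ℤ.+-identityʳ _)
  where j = suc j′

-- With F and T for the counts with flag `false` and `true`, summing `term-nice` gives F(a, K) =
-- T(a, K) + (y - 1) Σ F(a - t, K - t) over t ≥ 1.
weighted-peaks : ∀ j′ χ → PyramidInvariant (suc j′) χ → ∀ a K e → let j = suc j′ in
  weighted j false χ a (K ℕ.* j) e ≡ weighted j true χ a (K ℕ.* j) e +
    (delay 1 (λ c → pyramidSum j (term j false χ c) a K) e - pyramidSum j (term j false χ e) a K)
weighted-peaks j′ χ inv a K e = begin
  wordSum a N (term j false χ e)
    ≡⟨ wordSum-cong a N (λ w N≡ → trans
         (term-nice j χ e w (subst (j ∣_) (sym N≡) (n∣m*n K)))
         -- The subtraction becomes a multiple by -1, to which the linearity of `wordSum` applies.
         (cong (λ z → term j true χ e w + (delay 1 (λ c → peak j χ c w) e + z))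
           (sym (ℤ.-1*i≡-i (peak j χ e w))))) ⟩
  wordSum a N (λ w → term j true χ e w + (delay 1 (λ c → peak j χ c w) e + ℤ.-1ℤ * peak j χ e w))
    ≡⟨ trans (wordSum-+ a N _ _) (cong (ℤ._+_ (weighted j true χ a N e)) (wordSum-+ a N _ _)) ⟩
  weighted j true χ a N e +
    (wordSum a N (λ w → delay 1 (λ c → peak j χ c w) e) + wordSum a N (λ w → ℤ.-1ℤ * peak j χ e w))
    ≡⟨ cong (ℤ._+_ (weighted j true χ a N e)) (cong₂ _+_ (shifted e) (trans
         (wordSum-* a N ℤ.-1ℤ (peak j χ e))
         (trans (ℤ.-1*i≡-i _) (cong -_ (peakSum j′ χ inv a K e))))) ⟩
  weighted j true χ a N e + (delay 1 (λ c → pyramidSum j (term j false χ c) a K) e -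
    pyramidSum j (term j false χ e) a K) ∎
  where
  j = suc j′
  N = K ℕ.* j
  shifted : ∀ e → wordSum a N (λ w → delay 1 (λ c → peak j χ c w) e) ≡
    delay 1 (λ c → pyramidSum j (term j false χ c) a K) e
  shifted zero    = wordSum-zero a N
  shifted (suc e) = peakSum j′ χ inv a K e

weighted-noPeaks : ∀ j′ χ → PyramidInvariant (suc j′) χ → ∀ a K → let j = suc j′ in
  (∀ ψ → pyramidSum j ψ a K ≡ + 0) → ∀ e →
  weighted j false χ a (K ℕ.* j) e ≡ weighted j true χ a (K ℕ.* j) e
weighted-noPeaks j′ χ inv a K none e = trans (weighted-peaks j′ χ inv a K e)
  (trans (cong (ℤ._+_ total) (vanish e)) (ℤ.+-identityʳ total))
  where
  j = suc j′
  total = weighted j true χ a (K ℕ.* j) e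
  P : ℕ → ℤ
  P c = pyramidSum j (term j false χ c) a K
  vanish : ∀ e → delay 1 P e - P e ≡ + 0
  vanish zero    = cong (λ z → + 0 - z) (none _)
  vanish (suc e) = cong₂ _-_ (none _) (none _)

-- The corrections for (a + 1, K + 1) extend those for (a, K) by one term, so
-- substituting the previous lemma at (a, K) eliminates pyramidSum.
weighted-nice : ∀ j′ χ → PyramidInvariant (suc j′) χ → ∀ a K e → let j = suc j′ in
  weighted j false χ (suc a) (suc K ℕ.* j) e ≡
  (weighted j true χ (suc a) (suc K ℕ.* j) e - weighted j true χ a (K ℕ.* j) e) +
  delay 1 (weighted j false χ a (K ℕ.* j)) e
weighted-nice j′ χ inv a K e = trans (weighted-peaks j′ χ inv (suc a) (suc K) e) (go e)
  where
  j = suc j′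
  W = weighted j false χ a (K ℕ.* j)
  total = weighted j true χ
  P : ℕ → ℤ
  P c = pyramidSum j (term j false χ c) a K
  arith₀ : ∀ t u p → t + (+ 0 - ((u + (+ 0 - p)) + p)) ≡ (t - u) + + 0
  arith₀ = solve-∀
  arith : ∀ t w p u q → t + ((w + p) - ((u + (p - q)) + q)) ≡ (t - u) + w
  arith = solve-∀
  go : ∀ e → total (suc a) (suc K ℕ.* j) e + (delay 1 (λ c → W c + P c) e - (W e + P e)) ≡
    (total (suc a) (suc K ℕ.* j) e - total a (K ℕ.* j) e) + delay 1 W e
  go zero    = trans
    (cong (λ z → total (suc a) (suc K ℕ.* j) 0 + (+ 0 - (z + P 0))) (weighted-peaks j′ χ inv a K 0))
    (arith₀ (total (suc a) (suc K ℕ.* j) 0) (total a (K ℕ.* j) 0) (P 0))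
  go (suc e) = trans
    (cong (λ z → total (suc a) (suc K ℕ.* j) (suc e) + ((W e + P e) - (z + P (suc e))))
      (weighted-peaks j′ χ inv a K (suc e)))
    (arith (total (suc a) (suc K ℕ.* j) (suc e)) (W e) (P e) (total a (K ℕ.* j) (suc e)) (P (suc e)))

-- The run transform of the unweighted counts

-- The coefficient of x^k y^e in Σ_i g_i x^i ratio^(δ + i); the delay of g_i accounts for
-- the upsteps of the inserted pyramids, one for each further factor x.
-- δ is 0 when the current vertex is nice but follows an upstep, so that no pyramid can be
-- inserted there.
transform : ℕ → (ℕ → ℕ → ℤ) → ℕ → ℕ → ℕ → ℤ
transform δ g k a e = sumTo k λ i → pow ratio (δ ℕ.+ i) (k ∸ i) e * delay (k ∸ i) (g i) a

transform-cong : ∀ δ {g h : ℕ → ℕ → ℤ} → (∀ i a → g i a ≡ h i a) →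
  ∀ k a e → transform δ g k a e ≡ transform δ h k a e
transform-cong δ g≡h k a e = sumTo-cong k λ i _ →
  cong (pow ratio (δ ℕ.+ i) (k ∸ i) e *_) (delay-cong (k ∸ i) (g≡h i) a)

transform-+ : ∀ δ g h k a e → transform δ (λ i b → g i b + h i b) k a e ≡
  transform δ g k a e + transform δ h k a e
transform-+ δ g h k a e = trans
  (sumTo-cong k (λ i _ → trans
    (cong (pow ratio (δ ℕ.+ i) (k ∸ i) e *_) (delay-+ (k ∸ i) (g i) (h i) a))
    (ℤ.*-distribˡ-+ (pow ratio (δ ℕ.+ i) (k ∸ i) e) _ _)))
  (sumTo-+ k _ _)

transform-delay : ∀ δ g k a e → transform δ (λ i → delay 1 (g i)) k a e ≡
  delay 1 (λ b → transform δ g k b e) a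
transform-delay δ g k a e = trans
  (sumTo-cong k (λ i _ →
    cong (pow ratio (δ ℕ.+ i) (k ∸ i) e *_) (delay-comm (k ∸ i) (g i) a)))
  (go a)
  where
  go : ∀ a → sumTo k (λ i → pow ratio (δ ℕ.+ i) (k ∸ i) e * delay 1 (delay (k ∸ i) (g i)) a) ≡
    delay 1 (λ b → transform δ g k b e) a
  go zero    = sumTo-zero k (λ i _ → ℤ.*-zeroʳ (pow ratio (δ ℕ.+ i) (k ∸ i) e))
  go (suc a) = refl

-- The term i = 0 vanishes because `ratio`^0 = 1 has no coefficient at x^(k + 1); renumbering the
-- others raises δ from 0 to 1.
transform-suc : ∀ g k a e → transform 0 g (suc k) a e ≡ transform 1 (λ i → g (suc i)) k a e
transform-suc g k a e = sumTo-tail k _ refl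

-- Both shifts in `ratio-⊛` vanish at x^0, that is, `ratio` has constant term 1 in x.
ratio-nice₀ : ∀ p e → pow ratio (suc p) 0 e ≡ pow ratio p 0 e
ratio-nice₀ p e = trans (ratio-⊛ (pow ratio p) 0 e)
  (trans (ℤ.+-identityʳ _) (ℤ.+-identityʳ _))

pow-ratio₀ : ∀ p e → pow ratio p 0 e ≡ one 0 e
pow-ratio₀ zero    e = refl
pow-ratio₀ (suc p) e = trans (ratio-nice₀ p e) (pow-ratio₀ p e)

transform-zero : ∀ δ g a e → transform δ g 0 a e ≡ one 0 e * g 0 a
transform-zero δ g a e = cong (_* g 0 a) (pow-ratio₀ (δ ℕ.+ 0) e)

-- Without upsteps no pyramid fits: `delay` removes every term but i = k + 1, and there only the x^0
-- coefficient enters, which is the same for all powers of `ratio`.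
transform-nice-zero : ∀ g k e → transform 1 g (suc k) 0 e ≡ transform 0 g (suc k) 0 e
transform-nice-zero g k e = cong₂ _+_
  (sumTo-cong k (λ i i≤k → trans (vanish 1 i i≤k) (sym (vanish 0 i i≤k))))
  (trans (cong (λ l → pow ratio (suc (suc k)) l e * delay l (g (suc k)) 0) (ℕ.n∸n≡0 k))
    (trans (cong (_* g (suc k) 0) (ratio-nice₀ (suc k) e))
      (cong (λ l → pow ratio (suc k) l e * delay l (g (suc k)) 0) (sym (ℕ.n∸n≡0 k)))))
  where
  vanish : ∀ δ i → i ≤ k → pow ratio (δ ℕ.+ i) (suc k ∸ i) e * delay (suc k ∸ i) (g i) 0 ≡ + 0
  vanish δ i i≤k = trans
    (cong (λ l → pow ratio (δ ℕ.+ i) l e * delay l (g i) 0) (ℕ.+-∸-assoc 1 i≤k))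
    (ℤ.*-zeroʳ (pow ratio (δ ℕ.+ i) (suc (k ∸ i)) e))

-- This is the identity ratio = 1 - x + xy · ratio.
transform-nice : ∀ g k a e → transform 1 g (suc k) (suc a) e ≡
  (transform 0 g (suc k) (suc a) e - transform 0 g k a e) + delay 1 (transform 1 g k a) e
transform-nice g k a e = begin
  transform 1 g (suc k) (suc a) e
    ≡⟨ cong₂ _+_ (sumTo-cong k below) top ⟩
  sumTo k (λ i → (c₀ i (suc (k ∸ i)) * d i + - (c₀ i (k ∸ i) * d i)) + c₁ i * d i) + t
    ≡⟨ cong (_+ t) (trans (sumTo-+ k _ _)
         (cong₂ _+_ (trans (sumTo-+ k _ _) (cong (ℤ._+_ s) (sumTo-neg k _))) (shifted e))) ⟩
  ((s - transform 0 g k a e) + delay 1 (transform 1 g k a) e) + t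
    ≡⟨ arith s _ _ t ⟩
  ((s + t) - transform 0 g k a e) + delay 1 (transform 1 g k a) e
    ≡⟨ cong (λ z → (z - transform 0 g k a e) + delay 1 (transform 1 g k a) e)
         (cong (_+ t) (sumTo-cong k (λ i i≤k →
           cong (λ l → pow ratio i l e * delay l (g i) (suc a)) (sym (ℕ.+-∸-assoc 1 i≤k))))) ⟩
  (transform 0 g (suc k) (suc a) e - transform 0 g k a e) + delay 1 (transform 1 g k a) e ∎
  where
  c₀ : ℕ → ℕ → ℤ
  c₀ i l = pow ratio i l e
  c₁ : ℕ → ℤ
  c₁ i = delay 1 (pow ratio (suc i) (k ∸ i)) e
  d : ℕ → ℤ
  d i = delay (k ∸ i) (g i) a
  s t : ℤ
  s = sumTo k (λ i → c₀ i (suc (k ∸ i)) * d i)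
  t = pow ratio (suc k) (k ∸ k) e * delay (k ∸ k) (g (suc k)) (suc a)
  arith : ∀ s u v t → ((s - u) + v) + t ≡ ((s + t) - u) + v
  arith = solve-∀
  distrib : ∀ x y z w → ((x - y) + z) * w ≡ (x * w + - (y * w)) + z * w
  distrib = solve-∀
  below : ∀ i → i ≤ k →
    pow ratio (suc i) (suc k ∸ i) e * delay (suc k ∸ i) (g i) (suc a) ≡
    (c₀ i (suc (k ∸ i)) * d i + - (c₀ i (k ∸ i) * d i)) + c₁ i * d i
  below i i≤k = trans
    -- For i ≤ k the delay is positive and uses up one upstep of `suc a`; `ratio-⊛` then splits the
    -- coefficient.
    (cong (λ l → pow ratio (suc i) l e * delay l (g i) (suc a)) (ℕ.+-∸-assoc 1 i≤k))
    (trans (cong (_* d i) (ratio-⊛ (pow ratio i) (suc (k ∸ i)) e))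
      (distrib (c₀ i (suc (k ∸ i))) (c₀ i (k ∸ i)) (c₁ i) (d i)))
  -- At i = k + 1 only the x^0 coefficient enters, where one more factor `ratio` changes nothing.
  top : pow ratio (suc (suc k)) (k ∸ k) e * delay (k ∸ k) (g (suc k)) (suc a) ≡ t
  top = trans (cong (λ l → pow ratio (suc (suc k)) l e * delay l (g (suc k)) (suc a)) (ℕ.n∸n≡0 k))
    (trans (cong (_* g (suc k) (suc a)) (ratio-nice₀ (suc k) e))
      (cong (λ l → pow ratio (suc k) l e * delay l (g (suc k)) (suc a)) (sym (ℕ.n∸n≡0 k))))
  shifted : ∀ e → sumTo k (λ i → delay 1 (pow ratio (suc i) (k ∸ i)) e * d i) ≡
    delay 1 (transform 1 g k a) e
  shifted zero    = sumTo-zero k (λ _ _ → refl)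
  shifted (suc e) = refl

-- Weighted counts as transforms of unweighted counts

family : ℕ → (Word → Bool) → ℕ → ℕ → ℕ → ℤ
family j χ r i a = unweighted χ a (r ℕ.+ i ℕ.* j)

-- With flag `true` and no downstep to reset it, no ascent is ever counted.
weighted-noDowns : ∀ j χ a e → weighted j true χ a 0 e ≡ one 0 e * unweighted χ a 0
weighted-noDowns j χ zero    zero    = go (χ [])
  where
  go : ∀ b → [ b ∧ true ] ≡ + 1 * [ b ]
  go false = refl
  go true  = refl
weighted-noDowns j χ zero    (suc e) = cong [_] (∧-zeroʳ (χ []))
weighted-noDowns j χ (suc a) e       = weighted-noDowns j (λ w → χ (up ∷ w)) a e

-- The residue `r` of the number of downsteps decides. For r = 0 the recursion `weighted-nice` is
-- that of `transform-nice`; for r > 0 the vertex is not nice and the flag makes no difference.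
weighted-false : ∀ j′ k r → r ≤ j′ → ∀ χ → PyramidInvariant (suc j′) χ → ∀ a e →
  let j = suc j′ in weighted j false χ a (r ℕ.+ k ℕ.* j) e ≡ transform 1 (family j χ r) k a e

-- Both sides are additive over the first step: an upstep keeps the number of downsteps, a downstep
-- leads to `weighted-false` with residue `r`. The offset `suc r` runs from 1 to j, where j stands
-- for a nice vertex.
weighted-true : ∀ j′ k r → r ≤ j′ → ∀ χ → PyramidInvariant (suc j′) χ → ∀ a e →
  let j = suc j′ in
  weighted j true χ a (suc r ℕ.+ k ℕ.* j) e ≡ transform 1 (family j χ (suc r)) k a e

-- k + 1 blocks of j downsteps are k blocks with offset j; `transform-suc` turns δ = 1 for the
-- latter into δ = 0.
weighted-true-nice : ∀ j′ k χ → PyramidInvariant (suc j′) χ → ∀ a e →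
  let j = suc j′ in weighted j true χ a (k ℕ.* j) e ≡ transform 0 (family j χ 0) k a e

weighted-false j′ zero zero r≤j′ χ inv a e = begin
  weighted j false χ a 0 e   ≡⟨ weighted-noPeaks j′ χ inv a 0 (none a) e ⟩
  weighted j true χ a 0 e    ≡⟨ weighted-noDowns j χ a e ⟩
  one 0 e * unweighted χ a 0 ≡⟨ transform-zero 1 (family j χ 0) a e ⟨
  transform 1 (family j χ 0) 0 a e ∎
  where
  j = suc j′
  none : ∀ a ψ → pyramidSum j ψ a 0 ≡ + 0
  none zero    ψ = refl
  none (suc a) ψ = refl
weighted-false j′ (suc k) zero r≤j′ χ inv zero e =
  trans (weighted-noPeaks j′ χ inv zero (suc k) (λ _ → refl) e)
    (trans (weighted-true-nice j′ (suc k) χ inv zero e)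
      (sym (transform-nice-zero (family (suc j′) χ 0) k e)))
weighted-false j′ (suc k) zero r≤j′ χ inv (suc a) e = begin
  weighted j false χ (suc a) (suc k ℕ.* j) e
    ≡⟨ weighted-nice j′ χ inv a k e ⟩
  (weighted j true χ (suc a) (suc k ℕ.* j) e - weighted j true χ a (k ℕ.* j) e) +
    delay 1 (weighted j false χ a (k ℕ.* j)) e
    ≡⟨ cong₂ _+_ (cong₂ _-_ (weighted-true-nice j′ (suc k) χ inv (suc a) e)
         (weighted-true-nice j′ k χ inv a e))
         (delay-cong 1 (weighted-false j′ k zero r≤j′ χ inv a) e) ⟩
  (transform 0 g (suc k) (suc a) e - transform 0 g k a e) + delay 1 (transform 1 g k a) e
    ≡⟨ transform-nice g k a e ⟨
  transform 1 g (suc k) (suc a) e ∎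
  where
  j = suc j′
  g = family j χ 0
weighted-false j′ k (suc r) r<j′ χ inv a e = trans
  (weighted-notNice (suc j′) χ a (suc r ℕ.+ k ℕ.* suc j′) e (λ j∣N → >⇒∤ (s≤s r<j′)
    (∣m+n∣m⇒∣n (subst (suc j′ ∣_) (ℕ.+-comm (suc r) (k ℕ.* suc j′)) j∣N) (n∣m*n k))))
  (weighted-true j′ k r (ℕ.<⇒≤ r<j′) χ inv a e)

weighted-true j′ k r r≤j′ χ inv a e = begin
  weighted j true χ a (suc r ℕ.+ k ℕ.* j) e
    ≡⟨ wordSum-suc a (r ℕ.+ k ℕ.* j) (term j true χ e) ⟩
  delay 1 (λ b → weighted j true χu b (suc r ℕ.+ k ℕ.* j) e) a +
    weighted j false χd a (r ℕ.+ k ℕ.* j) e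
    ≡⟨ cong₂ _+_ (ups a) (weighted-false j′ k r r≤j′ χd (λ p → inv (dn ∷ p)) a e) ⟩
  delay 1 (λ b → transform 1 (family j χu (suc r)) k b e) a + transform 1 (family j χd r) k a e
    ≡⟨ cong (_+ transform 1 (family j χd r) k a e)
         (transform-delay 1 (family j χu (suc r)) k a e) ⟨
  transform 1 (λ i → delay 1 (family j χu (suc r) i)) k a e + transform 1 (family j χd r) k a e
    ≡⟨ transform-+ 1 _ _ k a e ⟨
  transform 1 (λ i b → delay 1 (family j χu (suc r) i) b + family j χd r i b) k a e
    ≡⟨ transform-cong 1 (λ i b → wordSum-suc b (r ℕ.+ i ℕ.* j) (λ w → [ χ w ])) k a e ⟨
  transform 1 (family j χ (suc r)) k a e ∎
  where
  j = suc j′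
  χu χd : Word → Bool
  χu w = χ (up ∷ w)
  χd w = χ (dn ∷ w)
  ups : ∀ a → delay 1 (λ b → weighted j true χu b (suc r ℕ.+ k ℕ.* j) e) a ≡
    delay 1 (λ b → transform 1 (family j χu (suc r)) k b e) a
  ups zero    = refl
  ups (suc a) = weighted-true j′ k r r≤j′ χu (λ p → inv (up ∷ p)) a e

weighted-true-nice j′ zero    χ inv a e = trans (weighted-noDowns (suc j′) χ a e)
  (sym (transform-zero 0 (family (suc j′) χ 0) a e))
weighted-true-nice j′ (suc k) χ inv a e = trans (weighted-true j′ k j′ ℕ.≤-refl χ inv a e)
  (sym (transform-suc (family (suc j′) χ 0) k a e))

-- Heights and remaining downsteps

units-++ : ∀ j p w → units j (p ++ w) ≡ units j p ++ units j w
units-++ j []       w = refl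
units-++ j (up ∷ p) w = trans (cong (replicate j U ++_) (units-++ j p w))
  (sym (++-assoc (replicate j U) (units j p) (units j w)))
units-++ j (dn ∷ p) w = cong (D ∷_) (units-++ j p w)

units-downs : ∀ j n w → units j (replicate n dn ++ w) ≡ replicate n D ++ units j w
units-downs j zero    w = refl
units-downs j (suc n) w = cong (D ∷_) (units-downs j n w)

units-insert : ∀ j p w → units j (p ++ up ∷ replicate j dn ++ w) ≡
  units j p ++ replicate j U ++ replicate j D ++ units j w
units-insert j p w = trans (units-++ j p _)
  (cong (λ v → units j p ++ replicate j U ++ v) (units-downs j j w))

replicate-∷ : ∀ {A : Set} n (x : A) v → replicate n x ++ x ∷ v ≡ x ∷ replicate n x ++ v
replicate-∷ zero    x v = refl
replicate-∷ (suc n) x v = cong (x ∷_) (replicate-∷ n x v)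

up-down : ∀ h → step D (step U h) ≡ h
up-down = cancel
  where
  cancel : ∀ h → (h + + 1) - + 1 ≡ h
  cancel = solve-∀

endHeight-prefix : ∀ h u v → endHeight h (u ++ v) ≡ endHeight (endHeight h u) v
endHeight-prefix h []      v = refl
endHeight-prefix h (s ∷ u) v = endHeight-prefix (step s h) u v

endHeight-pyramid : ∀ n h v → endHeight h (replicate n U ++ replicate n D ++ v) ≡ endHeight h v
endHeight-pyramid zero    h v = refl
endHeight-pyramid (suc n) h v = begin
  endHeight (step U h) (replicate n U ++ D ∷ replicate n D ++ v)
    -- One downstep moves across the descent, so that the inner pyramid U^n D^n stands alone before
    -- it.
    ≡⟨ cong (λ u → endHeight (step U h) (replicate n U ++ u)) (replicate-∷ n D v) ⟨
  endHeight (step U h) (replicate n U ++ replicate n D ++ D ∷ v)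
    ≡⟨ endHeight-pyramid n (step U h) (D ∷ v) ⟩
  endHeight (step D (step U h)) v
    ≡⟨ cong (λ z → endHeight z v) (up-down h) ⟩
  endHeight h v ∎

minHeight-prefix : ∀ u {v w} → (∀ h → minHeight h v ≡ minHeight h w) →
  ∀ h → minHeight h (u ++ v) ≡ minHeight h (u ++ w)
minHeight-prefix []      v≡w h = v≡w h
minHeight-prefix (s ∷ u) v≡w h = cong (h ℤ.⊓_) (minHeight-prefix u v≡w (step s h))

minHeight-≤ : ∀ h v → minHeight h v ℤ.≤ h
minHeight-≤ h []      = ℤ.≤-refl
minHeight-≤ h (s ∷ v) = ℤ.i⊓j≤i h _

-- A pyramid stays weakly above its base, whose height already enters the minimum over `v`.
minHeight-pyramid : ∀ n h v → minHeight h (replicate n U ++ replicate n D ++ v) ≡ minHeight h v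
minHeight-pyramid zero    h v = refl
minHeight-pyramid (suc n) h v = begin
  h ℤ.⊓ minHeight (step U h) (replicate n U ++ D ∷ replicate n D ++ v)
    ≡⟨ cong (λ u → h ℤ.⊓ minHeight (step U h) (replicate n U ++ u)) (replicate-∷ n D v) ⟨
  h ℤ.⊓ minHeight (step U h) (replicate n U ++ replicate n D ++ D ∷ v)
    ≡⟨ cong (h ℤ.⊓_) (minHeight-pyramid n (step U h) (D ∷ v)) ⟩
  h ℤ.⊓ (step U h ℤ.⊓ minHeight (step D (step U h)) v)
    ≡⟨ cong (λ z → h ℤ.⊓ (step U h ℤ.⊓ minHeight z v)) (up-down h) ⟩
  h ℤ.⊓ (step U h ℤ.⊓ minHeight h v)
    ≡⟨ cong (h ℤ.⊓_) (ℤ.i≥j⇒i⊓j≡j (ℤ.≤-trans (minHeight-≤ h v) (ℤ.i≤i+j h (+ 1)))) ⟩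
  h ℤ.⊓ minHeight h v
    ≡⟨ ℤ.i≥j⇒i⊓j≡j (minHeight-≤ h v) ⟩
  minHeight h v ∎

isPath-invariant : ∀ j m d → PyramidInvariant j (isPath j m d)
isPath-invariant j m d p w = cong₂ (λ a b → (a ==ℤ + 0) ∧ (b ==ℤ - (+ d)))
  (begin
    endHeight h (units j (p ++ up ∷ replicate j dn ++ w))
      ≡⟨ cong (endHeight h) (units-insert j p w) ⟩
    endHeight h (units j p ++ replicate j U ++ replicate j D ++ units j w)
      ≡⟨ endHeight-prefix h (units j p) _ ⟩
    endHeight (endHeight h (units j p)) (replicate j U ++ replicate j D ++ units j w)
      ≡⟨ endHeight-pyramid j _ (units j w) ⟩
    endHeight (endHeight h (units j p)) (units j w)
      ≡⟨ endHeight-prefix h (units j p) (units j w) ⟨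
    endHeight h (units j p ++ units j w)
      ≡⟨ cong (endHeight h) (units-++ j p w) ⟨
    endHeight h (units j (p ++ w)) ∎)
  (begin
    minHeight h (units j (p ++ up ∷ replicate j dn ++ w))
      ≡⟨ cong (minHeight h) (units-insert j p w) ⟩
    minHeight h (units j p ++ replicate j U ++ replicate j D ++ units j w)
      ≡⟨ minHeight-prefix (units j p) (λ h → minHeight-pyramid j h (units j w)) h ⟩
    minHeight h (units j p ++ units j w)
      ≡⟨ cong (minHeight h) (units-++ j p w) ⟨
    minHeight h (units j (p ++ w)) ∎)
  where h = + m

countUp : Word → ℕ
countUp []       = 0
countUp (up ∷ w) = suc (countUp w)
countUp (dn ∷ w) = countUp w

endHeight-ups : ∀ n h → endHeight h (replicate n U) ≡ h + + n
endHeight-ups zero    h = sym (ℤ.+-identityʳ h)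
endHeight-ups (suc n) h = trans (endHeight-ups n (step U h)) (ℤ.+-assoc h (+ 1) (+ n))

endHeight-units : ∀ j h w → endHeight h (units j w) ≡ (h + + (countUp w ℕ.* j)) - + countDn w
endHeight-units j h []       = sym (trans (ℤ.+-identityʳ _) (ℤ.+-identityʳ h))
endHeight-units j h (up ∷ w) = begin
  endHeight h (replicate j U ++ units j w)
    ≡⟨ endHeight-prefix h (replicate j U) (units j w) ⟩
  endHeight (endHeight h (replicate j U)) (units j w)
    ≡⟨ cong (λ z → endHeight z (units j w)) (endHeight-ups j h) ⟩
  endHeight (h + + j) (units j w)
    ≡⟨ endHeight-units j (h + + j) w ⟩
  (h + + j + + (countUp w ℕ.* j)) - + countDn w
    ≡⟨ cong (_- + countDn w) (ℤ.+-assoc h (+ j) (+ (countUp w ℕ.* j))) ⟩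
  (h + + (j ℕ.+ countUp w ℕ.* j)) - + countDn w ∎
endHeight-units j h (dn ∷ w) = trans (endHeight-units j (step D h) w)
  (arith h (+ (countUp w ℕ.* j)) (+ countDn w))
  where
  arith : ∀ h c n → ((h - + 1) + c) - n ≡ (h + c) - (+ 1 + n)
  arith = solve-∀

endsAtZero : ∀ j h w → endHeight h (units j w) ≡ + 0 → h + + (countUp w ℕ.* j) ≡ + countDn w
endsAtZero j h w end≡0 = ℤ.i-j≡0⇒i≡j _ _ (trans (sym (endHeight-units j h w)) end≡0)

runU-ups : ∀ n v → runU (replicate n U ++ v) ≡ n ℕ.+ runU v
runU-ups zero    v = refl
runU-ups (suc n) v = cong suc (runU-ups n v)

dropN-ups : ∀ n k v → dropN (n ℕ.+ k) (replicate n U ++ v) ≡ dropN k v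
dropN-ups zero    k v = refl
dropN-ups (suc n) k v = dropN-ups n k v

-- Unit upsteps come in blocks of j, so those after the initial run number a multiple of j. On a
-- path ending at 0, the height of the peak and the number of later downsteps therefore agree modulo
-- j.
countUp-runU : ∀ j w → ∃ λ c → countUp w ℕ.* j ≡ runU (units j w) ℕ.+ c ℕ.* j
countUp-runU j []       = 0 , refl
countUp-runU j (dn ∷ w) = countUp w , refl
countUp-runU j (up ∷ w) with countUp-runU j w
... | c , eq = c , (begin
  j ℕ.+ countUp w ℕ.* j               ≡⟨ cong (j ℕ.+_) eq ⟩
  j ℕ.+ (runU (units j w) ℕ.+ c ℕ.* j) ≡⟨ ℕ.+-assoc j _ _ ⟨
  j ℕ.+ runU (units j w) ℕ.+ c ℕ.* j   ≡⟨ cong (ℕ._+ c ℕ.* j) (runU-ups j (units j w)) ⟨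
  runU (units j (up ∷ w)) ℕ.+ c ℕ.* j  ∎)

multiple-cong : ∀ j m n → (j ∣ m → j ∣ n) → (j ∣ n → j ∣ m) → ⌊ j ∣? m ⌋ ≡ ⌊ j ∣? n ⌋
multiple-cong j m n to from with j ∣? m
... | yes j∣m = sym (multiple j (to j∣m))
... | no  j∤m = sym (notMultiple j (λ j∣n → j∤m (from j∣n)))

-- Divisibility is transferred through the integers, as a peak below the axis has negative height
-- `z`.
nice-height : ∀ j z c n → z + + (c ℕ.* j) ≡ + n → ⌊ j ∣? ℤ.∣ z ∣ ⌋ ≡ ⌊ j ∣? n ⌋
nice-height j z c n eq = multiple-cong j ℤ.∣ z ∣ n
  (λ j∣z → ∣⇒∣ᵤ (subst (+ j Signed.∣_) eq
    (Signed.∣m∣n⇒∣m+n (∣ᵤ⇒∣ {+ j} {z} j∣z) j∣cj)))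
  (λ j∣n → ∣⇒∣ᵤ (Signed.∣m+n∣n⇒∣m {+ j} {z}
    (subst (+ j Signed.∣_) (sym eq) (∣ᵤ⇒∣ {+ j} {+ n} j∣n)) j∣cj))
  where
  j∣cj : + j Signed.∣ + (c ℕ.* j)
  j∣cj = ∣ᵤ⇒∣ {+ j} {+ (c ℕ.* j)} (n∣m*n c)

suc-≤ᵇ : ∀ s t → (suc s ℕ.≤ᵇ suc t) ≡ (s ℕ.≤ᵇ t)
suc-≤ᵇ zero    t = refl
suc-≤ᵇ (suc s) t = refl

-- With j = `suc j′` an upstep begins with a `U`, so it ends the run of `D`s.
beginsWithDowns-runD : ∀ j′ t w → beginsWithDowns t w ≡ (t ℕ.≤ᵇ runD (units (suc j′) w))
beginsWithDowns-runD j′ zero    w        = refl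
beginsWithDowns-runD j′ (suc t) []       = refl
beginsWithDowns-runD j′ (suc t) (up ∷ w) = refl
beginsWithDowns-runD j′ (suc t) (dn ∷ w) =
  trans (beginsWithDowns-runD j′ t w) (sym (suc-≤ᵇ t _))

-- The ascent consists of the kj unit upsteps already read and the run at the start of `w`; each
-- further upstep moves j from the second to the first.
completesPyramid-runs : ∀ j′ k w → let u = units (suc j′) w in
  completesPyramid (suc j′) k w ≡ (k ℕ.* suc j′ ℕ.+ runU u ℕ.≤ᵇ runD (dropN (runU u) u))
completesPyramid-runs j′ k []       = trans (beginsWithDowns-runD j′ (k ℕ.* suc j′) [])
  (cong (ℕ._≤ᵇ 0) (sym (ℕ.+-identityʳ (k ℕ.* suc j′))))
completesPyramid-runs j′ k (dn ∷ w) = trans (beginsWithDowns-runD j′ (k ℕ.* suc j′) (dn ∷ w))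
  (cong (ℕ._≤ᵇ suc (runD (units (suc j′) w))) (sym (ℕ.+-identityʳ (k ℕ.* suc j′))))
completesPyramid-runs j′ k (up ∷ w) = trans (completesPyramid-runs j′ (suc k) w)
  (cong₂ ℕ._≤ᵇ_
    (trans (cong (ℕ._+ R) (ℕ.+-comm j (k ℕ.* j))) (trans (ℕ.+-assoc (k ℕ.* j) j R)
      (cong (k ℕ.* j ℕ.+_) (sym runU≡))))
    (cong runD (sym (trans (cong (λ l → dropN l (units j (up ∷ w))) runU≡)
      (dropN-ups j R (units j w))))))
  where
  j = suc j′
  R = runU (units j w)
  runU≡ : runU (units j (up ∷ w)) ≡ j ℕ.+ R
  runU≡ = runU-ups j (units j w)

npaGo-ups : ∀ j n h v →
  npaGo j true h (replicate n U ++ v) ≡ npaGo j true (endHeight h (replicate n U)) v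
npaGo-ups j zero    h v = refl
npaGo-ups j (suc n) h v = npaGo-ups j n (step U h) v

-- The end condition turns heights of peaks into numbers of later downsteps modulo j, and it is
-- inherited by suffixes.
npaGo-units : ∀ j′ p h w → let j = suc j′ in
  endHeight h (units j w) ≡ + 0 → npaGo j p h (units j w) ≡ npaSuffix j p w
npaGo-units j′ p     h []       end≡0 = refl
npaGo-units j′ p     h (dn ∷ w) end≡0 = npaGo-units j′ false (step D h) w end≡0
npaGo-units j′ true  h (up ∷ w) end≡0 =
  trans (npaGo-ups (suc j′) (suc j′) h (units (suc j′) w))
    (npaGo-units j′ true (endHeight h (replicate (suc j′) U)) w
      (trans (sym (endHeight-prefix h (replicate (suc j′) U) (units (suc j′) w))) end≡0))
npaGo-units j′ false h (up ∷ w) end≡0 = cong₂ ℕ._+_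
  (cong₂ (λ b c → if b ∧ c then 1 else 0) pyramid nice)
  (trans (npaGo-ups (suc j′) (suc j′) h (units (suc j′) w))
    (npaGo-units j′ true (endHeight h (replicate (suc j′) U)) w
      (trans (sym (endHeight-prefix h (replicate (suc j′) U) (units (suc j′) w))) end≡0)))
  where
  j = suc j′
  u = units j (up ∷ w)
  pyramid : (runU u ℕ.≤ᵇ runD (dropN (runU u) u)) ≡ completesPyramid j 1 w
  -- Started at k = 0, before the ascent, the comparison is with the full run of `U`s.
  pyramid = sym (completesPyramid-runs j′ 0 (up ∷ w))
  nice : ⌊ j ∣? ℤ.∣ h + + runU u ∣ ⌋ ≡ ⌊ j ∣? countDn w ⌋
  nice with countUp-runU j (up ∷ w)
  ... | c , eq = nice-height j (h + + runU u) c (countDn w) (begin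
    h + + runU u + + (c ℕ.* j)       ≡⟨ ℤ.+-assoc h (+ runU u) (+ (c ℕ.* j)) ⟩
    h + + (runU u ℕ.+ c ℕ.* j)       ≡⟨ cong (λ z → h + + z) eq ⟨
    h + + (countUp (up ∷ w) ℕ.* j)   ≡⟨ endsAtZero j h (up ∷ w) end≡0 ⟩
    + countDn w                      ∎)

-- Enumeration of the candidates

listSum : (Word → ℤ) → List Word → ℤ
listSum φ []       = + 0
listSum φ (w ∷ ws) = φ w + listSum φ ws

length-filter : ∀ P ws → + length (filterᵇ P ws) ≡ listSum (λ w → [ P w ]) ws
length-filter P []       = refl
length-filter P (w ∷ ws) with P w
... | true  = cong (ℤ._+_ (+ 1)) (length-filter P ws)
... | false = trans (length-filter P ws) (sym (ℤ.+-identityˡ _))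

listSum-++ : ∀ φ us vs → listSum φ (us ++ vs) ≡ listSum φ us + listSum φ vs
listSum-++ φ []       vs = sym (ℤ.+-identityˡ _)
listSum-++ φ (u ∷ us) vs = trans (cong (ℤ._+_ (φ u)) (listSum-++ φ us vs))
  (sym (ℤ.+-assoc (φ u) (listSum φ us) (listSum φ vs)))

listSum-map : ∀ φ s ws → listSum φ (map (s ∷_) ws) ≡ listSum (λ w → φ (s ∷ w)) ws
listSum-map φ s []       = refl
listSum-map φ s (w ∷ ws) = cong (ℤ._+_ (φ (s ∷ w))) (listSum-map φ s ws)

listSum-words-suc : ∀ φ L → listSum φ (words (suc L)) ≡
  listSum (λ w → φ (up ∷ w)) (words L) + listSum (λ w → φ (dn ∷ w)) (words L)
listSum-words-suc φ L = trans (listSum-++ φ (map (up ∷_) (words L)) (map (dn ∷_) (words L)))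
  (cong₂ _+_ (listSum-map φ up (words L)) (listSum-map φ dn (words L)))

listSum-words-zero : ∀ L φ → (∀ w → countUp w ℕ.+ countDn w ≡ L → φ w ≡ + 0) →
  listSum φ (words L) ≡ + 0
listSum-words-zero zero    φ φ≡0 = trans (ℤ.+-identityʳ (φ [])) (φ≡0 [] refl)
listSum-words-zero (suc L) φ φ≡0 = trans (listSum-words-suc φ L) (cong₂ _+_
  (listSum-words-zero L _ (λ w eq → φ≡0 (up ∷ w) (cong suc eq)))
  (listSum-words-zero L _ (λ w eq → φ≡0 (dn ∷ w)
    (trans (ℕ.+-suc (countUp w) (countDn w)) (cong suc eq)))))

-- Start, end and size of a path fix both step counts, so the indicators summed over the candidates
-- have this property.
SupportedOn : ℕ → ℕ → (Word → ℤ) → Set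
SupportedOn a N φ = ∀ w → ¬ (countUp w ≡ a × countDn w ≡ N) → φ w ≡ + 0

listSum-words : ∀ a N φ → SupportedOn a N φ → listSum φ (words (a ℕ.+ N)) ≡ wordSum a N φ
listSum-words zero    zero    φ supp = ℤ.+-identityʳ (φ [])
listSum-words (suc a) zero    φ supp = trans (listSum-words-suc φ (a ℕ.+ 0)) (trans
  (cong₂ _+_
    (listSum-words a zero _ (λ w ne → supp (up ∷ w) (λ (u , d) → ne (ℕ.suc-injective u , d))))
    (listSum-words-zero (a ℕ.+ 0) _ (λ w _ → supp (dn ∷ w) (λ ()))))
  (ℤ.+-identityʳ _))
listSum-words zero    (suc N) φ supp = trans (listSum-words-suc φ N) (trans
  (cong₂ _+_
    (listSum-words-zero N _ (λ w _ → supp (up ∷ w) (λ ())))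
    (listSum-words zero N _ (λ w ne → supp (dn ∷ w) (λ (u , d) → ne (u , ℕ.suc-injective d)))))
  (ℤ.+-identityˡ _))
listSum-words (suc a) (suc N) φ supp = trans (listSum-words-suc φ (a ℕ.+ suc N)) (cong₂ _+_
  (listSum-words a (suc N) _ (λ w ne → supp (up ∷ w) (λ (u , d) → ne (ℕ.suc-injective u , d))))
  (trans (cong (λ L → listSum (λ w → φ (dn ∷ w)) (words L)) (ℕ.+-suc a N))
    (listSum-words (suc a) N _
      (λ w ne → supp (dn ∷ w) (λ (u , d) → ne (u , ℕ.suc-injective d))))))

listSum-wordsUpTo : ∀ φ B → listSum φ (wordsUpTo B) ≡ sumTo B (λ L → listSum φ (words L))
listSum-wordsUpTo φ zero    = cong (listSum φ) (++-identityʳ (words 0))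
listSum-wordsUpTo φ (suc B) = begin
  listSum φ (concatMap words (upTo (suc (suc B))))
    ≡⟨ cong (λ l → listSum φ (concatMap words l)) (upTo-∷ʳ (suc B)) ⟨
  listSum φ (concatMap words (upTo (suc B) ++ suc B ∷ []))
    ≡⟨ cong (listSum φ) (concatMap-++ words (upTo (suc B)) (suc B ∷ [])) ⟩
  listSum φ (wordsUpTo B ++ words (suc B) ++ [])
    ≡⟨ listSum-++ φ (wordsUpTo B) (words (suc B) ++ []) ⟩
  listSum φ (wordsUpTo B) + listSum φ (words (suc B) ++ [])
    ≡⟨ cong₂ _+_ (listSum-wordsUpTo φ B) (cong (listSum φ) (++-identityʳ (words (suc B)))) ⟩
  sumTo (suc B) (λ L → listSum φ (words L)) ∎

sumTo-single : ∀ {k n} (f : ℕ → ℤ) → k ≤ n → (∀ i → i ≢ k → f i ≡ + 0) → sumTo n f ≡ f k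
sumTo-single {k} f k≤n f≡0 =
  trans (sym (sumTo-extend f k≤n (λ i k<i → f≡0 i (ℕ.>⇒≢ k<i)))) (last k f≡0)
  where
  last : ∀ k → (∀ i → i ≢ k → f i ≡ + 0) → sumTo k f ≡ f k
  last zero    f≡0 = refl
  last (suc k) f≡0 = trans
    (cong (_+ f (suc k)) (sumTo-zero k (λ i i≤k → f≡0 i (ℕ.<⇒≢ (s≤s i≤k)))))
    (ℤ.+-identityˡ _)

listSum-supported : ∀ {a N B} φ → SupportedOn a N φ → a ℕ.+ N ≤ B →
  listSum φ (wordsUpTo B) ≡ wordSum a N φ
listSum-supported {a} {N} {B} φ supp a+N≤B = trans (listSum-wordsUpTo φ B)
  (trans (sumTo-single _ a+N≤B (λ L L≢ → listSum-words-zero L φ (λ w eq →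
      supp w (λ (u , d) → L≢ (trans (sym eq) (cong₂ ℕ._+_ u d))))))
    (listSum-words a N φ supp))

-- Step counts of the paths of a given size

==ℤ⇒≡ : ∀ a b → (a ==ℤ b) ≡ true → a ≡ b
==ℤ⇒≡ a b eq with a ℤ.≟ b
==ℤ⇒≡ a b eq | yes a≡b = a≡b
==ℤ⇒≡ a b () | no  _

∧-true : ∀ a {b} → a ∧ b ≡ true → a ≡ true × b ≡ true
∧-true true eq = refl , eq

≡ᵇ-true : ∀ {m n} → (m ≡ᵇ n) ≡ true → m ≡ n
≡ᵇ-true {m} {n} eq = ℕ.≡ᵇ⇒≡ m n (subst T (sym eq) tt)

≡ᵇ-refl : ∀ n → (n ≡ᵇ n) ≡ true
≡ᵇ-refl zero    = refl
≡ᵇ-refl (suc n) = ≡ᵇ-refl n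

isPath⇒endHeight : ∀ j m d w → isPath j m d w ≡ true → endHeight (+ m) (units j w) ≡ + 0
isPath⇒endHeight j m d w path = ==ℤ⇒≡ _ _ (proj₁ (∧-true _ path))

[r+nj]/j≡n : ∀ j {{_ : NonZero j}} {r} n → r < j → (r ℕ.+ n ℕ.* j) / j ≡ n
[r+nj]/j≡n j {r} n r<j = trans (+-distrib-/-∣ʳ r (n∣m*n n))
  (cong₂ ℕ._+_ (m<n⇒m/n≡0 r<j) (m*n/n≡m n j))

-- Ending at 0 means that m plus j times the number of upsteps is the number of downsteps;
-- remainders and quotients by j then give both counts.
path-counts : ∀ j m d {{_ : NonZero j}} w n → isPath j m d w ≡ true → size j w ≡ n →
  m / j ℕ.+ countUp w ≡ n × countDn w ≡ m % j ℕ.+ n ℕ.* j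
path-counts j m d w n path size≡n = ups , downs
  where
  balance : m ℕ.+ countUp w ℕ.* j ≡ countDn w
  balance = ℤ.+-injective (endsAtZero j (+ m) w (isPath⇒endHeight j m d w path))
  downs : countDn w ≡ m % j ℕ.+ n ℕ.* j
  downs = trans (m≡m%n+[m/n]*n (countDn w) j) (cong₂ (λ r q → r ℕ.+ q ℕ.* j)
    (trans (cong (_% j) (sym balance)) ([m+kn]%n≡m%n m (countUp w) j)) size≡n)
  ups : m / j ℕ.+ countUp w ≡ n
  ups = begin
    m / j ℕ.+ countUp w                   ≡⟨ cong (m / j ℕ.+_) (m*n/n≡m (countUp w) j) ⟨
    m / j ℕ.+ countUp w ℕ.* j / j         ≡⟨ +-distrib-/-∣ʳ m (n∣m*n (countUp w)) ⟨
    (m ℕ.+ countUp w ℕ.* j) / j           ≡⟨ cong (_/ j) balance ⟩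
    countDn w / j                         ≡⟨ size≡n ⟩
    n                                     ∎

-- `Q` is trivial for `gSeries` and fixes the number of nice pyramid ascents for `npaSeries`, so one
-- argument serves both.
count-paths : ∀ j m d {{_ : NonZero j}} n (P Q : Word → Bool) →
  (∀ w → P w ≡ isPath j m d w ∧ (size j w ≡ᵇ n) ∧ Q w) → m / j ≤ n →
  + length (filterᵇ P (candidates j n)) ≡
  wordSum (n ∸ m / j) (m % j ℕ.+ n ℕ.* j) (λ w → [ isPath j m d w ∧ Q w ])
count-paths j m d n P Q P≡ q≤n = trans (length-filter P (candidates j n)) (trans
  (listSum-supported _ supp bound)
  (wordSum-cong (n ∸ m / j) (m % j ℕ.+ n ℕ.* j) (λ w N≡ → cong [_] (trans (P≡ w)
    (cong (λ b → isPath j m d w ∧ b ∧ Q w) (trans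
      (cong (_≡ᵇ n) (trans (cong (_/ j) N≡) ([r+nj]/j≡n j n (m%n<n m j))))
      (≡ᵇ-refl n)))))))
  where
  supp : SupportedOn (n ∸ m / j) (m % j ℕ.+ n ℕ.* j) (λ w → [ P w ])
  supp w ne with P w in eq
  ... | false = refl
  ... | true with ∧-true (isPath j m d w) (trans (sym (P≡ w)) eq)
  ...   | path , rest with path-counts j m d w n path (≡ᵇ-true (proj₁ (∧-true _ rest)))
  ...     | ups , downs = contradiction
    (trans (sym (ℕ.m+n∸m≡n (m / j) (countUp w))) (cong (_∸ m / j) ups) , downs) ne
  -- Each count is at most (n + 1)j: there are at most `n` upsteps and j ≥ 1, and m % j < j bounds
  -- the downsteps.
  bound : n ∸ m / j ℕ.+ (m % j ℕ.+ n ℕ.* j) ≤ 2 ℕ.* j ℕ.* suc n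
  bound = subst (n ∸ m / j ℕ.+ (m % j ℕ.+ n ℕ.* j) ≤_) rearrange (ℕ.+-mono-≤
    (ℕ.≤-trans (ℕ.m∸n≤m n (m / j)) (ℕ.≤-trans (ℕ.m≤m*n n j) (ℕ.m≤n+m (n ℕ.* j) j)))
    (ℕ.+-monoˡ-≤ (n ℕ.* j) (ℕ.<⇒≤ (m%n<n m j))))
    where
    rearrange : suc n ℕ.* j ℕ.+ suc n ℕ.* j ≡ 2 ℕ.* j ℕ.* suc n
    rearrange = trans (cong (suc n ℕ.* j ℕ.+_) (sym (ℕ.+-identityʳ (suc n ℕ.* j))))
      (trans (cong (2 ℕ.*_) (ℕ.*-comm (suc n) j)) (sym (ℕ.*-assoc 2 j (suc n))))

count-no-paths : ∀ j m d {{_ : NonZero j}} n (P Q : Word → Bool) →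
  (∀ w → P w ≡ isPath j m d w ∧ (size j w ≡ᵇ n) ∧ Q w) → n < m / j →
  + length (filterᵇ P (candidates j n)) ≡ + 0
count-no-paths j m d n P Q P≡ n<q = trans (length-filter P (candidates j n)) (trans
  (listSum-wordsUpTo _ (2 ℕ.* j ℕ.* suc n))
  (sumTo-zero (2 ℕ.* j ℕ.* suc n) (λ L _ → listSum-words-zero L _ (λ w _ → none w))))
  where
  none : ∀ w → [ P w ] ≡ + 0
  none w with P w in eq
  ... | false = refl
  ... | true with ∧-true (isPath j m d w) (trans (sym (P≡ w)) eq)
  ...   | path , rest with path-counts j m d w n path (≡ᵇ-true (proj₁ (∧-true _ rest)))
  ...     | ups , _ = contradiction (subst (m / j ≤_) ups (ℕ.m≤m+n (m / j) (countUp w)))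
    (ℕ.<⇒≱ n<q)

unmarked : ∀ j m d {{_ : NonZero j}} n w → isPath j m d w ∧ (size j w ≡ᵇ n) ≡
  isPath j m d w ∧ (size j w ≡ᵇ n) ∧ true
unmarked j m d n w = cong (isPath j m d w ∧_) (sym (∧-identityʳ (size j w ≡ᵇ n)))

gSeries-none : ∀ j m d {{_ : NonZero j}} i → i < m / j → gSeries j m d i 0 ≡ + 0
gSeries-none j m d i = count-no-paths j m d i _ (λ _ → true) (unmarked j m d i)

-- A path of size i has n - i upsteps fewer than one of size n, which is the delay in `transform`.
-- For i < m / j there is no path, and the delay exceeds the index.
gSeries-delay : ∀ j m d {{_ : NonZero j}} n i → m / j ≤ n → i ≤ n →
  gSeries j m d i 0 ≡ delay (n ∸ i) (family j (isPath j m d) (m % j) i) (n ∸ m / j)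
gSeries-delay j m d n i q≤n i≤n with m / j ℕ.≤? i
... | yes q≤i = begin
  gSeries j m d i 0
    ≡⟨ count-paths j m d i _ (λ _ → true) (unmarked j m d i) q≤i ⟩
  wordSum (i ∸ m / j) (m % j ℕ.+ i ℕ.* j) (λ w → [ isPath j m d w ∧ true ])
    ≡⟨ wordSum-cong (i ∸ m / j) _ (λ w _ → cong [_] (∧-identityʳ (isPath j m d w))) ⟩
  family j (isPath j m d) (m % j) i (i ∸ m / j)
    ≡⟨ cong (family j (isPath j m d) (m % j) i) index ⟨
  family j (isPath j m d) (m % j) i ((n ∸ m / j) ∸ (n ∸ i))
    ≡⟨ delay-≤ _ (ℕ.∸-monoʳ-≤ n q≤i) ⟨
  delay (n ∸ i) (family j (isPath j m d) (m % j) i) (n ∸ m / j) ∎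
  where
  index : (n ∸ m / j) ∸ (n ∸ i) ≡ i ∸ m / j
  index = begin
    (n ∸ m / j) ∸ (n ∸ i)  ≡⟨ ℕ.∸-+-assoc n (m / j) (n ∸ i) ⟩
    n ∸ (m / j ℕ.+ (n ∸ i)) ≡⟨ cong (n ∸_) (ℕ.+-comm (m / j) (n ∸ i)) ⟩
    n ∸ (n ∸ i ℕ.+ m / j)  ≡⟨ ℕ.∸-+-assoc n (n ∸ i) (m / j) ⟨
    (n ∸ (n ∸ i)) ∸ m / j  ≡⟨ cong (_∸ m / j) (ℕ.m∸[m∸n]≡n i≤n) ⟩
    i ∸ m / j              ∎
... | no q≰i = trans (gSeries-none j m d i (ℕ.≰⇒> q≰i))
  (sym (delay-> _ (ℕ.∸-monoʳ-< (ℕ.≰⇒> q≰i) q≤n)))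

npaSeries-weighted : ∀ j′ m d n e → let j = suc j′ in m / j ≤ n →
  npaSeries j m d n e ≡ weighted j false (isPath j m d) (n ∸ m / j) (m % j ℕ.+ n ℕ.* j) e
npaSeries-weighted j′ m d n e q≤n = trans
  (count-paths j m d n _ (λ w → npa j m w ≡ᵇ e) (λ _ → refl) q≤n)
  (wordSum-cong (n ∸ m / j) (m % j ℕ.+ n ℕ.* j) (λ w _ → agree w))
  where
  j = suc j′
  agree : ∀ w → [ isPath j m d w ∧ (npa j m w ≡ᵇ e) ] ≡ term j false (isPath j m d) e w
  agree w with isPath j m d w in path
  ... | false = refl
  ... | true  = cong (λ s → [ s ≡ᵇ e ])
    (npaGo-units j′ false (+ m) w (isPath⇒endHeight j m d w path))

theorem7 : (j m d : ℕ) {{_ : NonZero j}} → (n e : ℕ) →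
    Φ (gSeries j m d) n e ≡ npaSeries j m d n e
theorem7 j@(suc j′) m d n e with m / j ℕ.≤? n
... | yes q≤n = begin
  Φ (gSeries j m d) n e
    ≡⟨ Φ-expand (gSeries j m d) (λ _ _ → refl) n e ⟩
  sumTo n (λ i → pow ratio (suc i) (n ∸ i) e * gSeries j m d i 0)
    ≡⟨ sumTo-cong n (λ i i≤n →
         cong (pow ratio (suc i) (n ∸ i) e *_) (gSeries-delay j m d n i q≤n i≤n)) ⟩
  transform 1 (family j (isPath j m d) (m % j)) n (n ∸ m / j) e
    ≡⟨ weighted-false j′ n (m % j) (ℕ.<⇒≤pred (m%n<n m j)) (isPath j m d)
         (isPath-invariant j m d) (n ∸ m / j) e ⟨
  weighted j false (isPath j m d) (n ∸ m / j) (m % j ℕ.+ n ℕ.* j) e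
    ≡⟨ npaSeries-weighted j′ m d n e q≤n ⟨
  npaSeries j m d n e ∎
-- A size is m / j plus the number of upsteps, so no path has size `n` or less and both sides
-- vanish.
... | no q≰n = begin
  Φ (gSeries j m d) n e
    ≡⟨ Φ-expand (gSeries j m d) (λ _ _ → refl) n e ⟩
  sumTo n (λ i → pow ratio (suc i) (n ∸ i) e * gSeries j m d i 0)
    ≡⟨ sumTo-zero n (λ i i≤n → trans
         (cong (pow ratio (suc i) (n ∸ i) e *_)
           (gSeries-none j m d i (ℕ.≤-<-trans i≤n (ℕ.≰⇒> q≰n))))
         (ℤ.*-zeroʳ (pow ratio (suc i) (n ∸ i) e))) ⟩
  + 0
    ≡⟨ count-no-paths j m d n _ (λ w → npa j m w ≡ᵇ e) (λ _ → refl) (ℕ.≰⇒> q≰n) ⟨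
  npaSeries j m d n e ∎
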